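{- Let $m \geq 1$ be an integer and let $q \in (m,m+1)$ be a Pisot number which is also a simple Parry number. Then every Galois conjugate $q'$ of $q$ satisfies $|q'| \geq c_m$. More precisely, if $q' \neq q$ is a real Galois conjugate of $q$, then \[ |q'| \geq \frac{\sqrt{m^2+4}-m}{2} \geq c_m. \]
   Context: A Pisot number is a real algebraic integer $q>1$ all of whose other Galois conjugates have absolute value strictly less than $1$. A real number $q>1$ is a simple Parry number if the greedy $q$-expansion of $1$ is finite, i.e. $1 = \sum_{i=1}^n a_i q^{ -i}$ with digits $a_i$ produced by the greedy algorithm (iterating $x \mapsto qx \bmod 1$ from $1$ terminates at $0$). Define $c_1 = \frac{\sqrt{5}-1}{2}$; define $c_2$ to be the absolute value of the root of minimal modulus of $x^4-3x^3+x^2-2x-1$; and for $m \geq 3$ define $c_m = \frac{m+1-\sqrt{m^2+2m-3}}{2}$. -}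

module Defs where

open import Algebra.Apartness.Bundles using (HeytingField)
open import Algebra.Bundles using (CommutativeRing)
open import Data.Integer.Base as ℤ using (ℤ; +_; -[1+_])
open import Data.List.Base using (List; []; _∷_)
open import Data.Nat.Base as ℕ using (ℕ; zero; suc; NonZero)
open import Data.Product.Base using (_×_; _,_; proj₁; ∃-syntax; Σ-syntax)
open import Data.Rational.Base as ℚ using (ℚ)
open import Data.Sum.Base using (_⊎_; inj₁; inj₂; [_,_]′)
open import Data.Vec.Base as Vec using (Vec; []; _∷_)
import Level
open import Relation.Binary.Core using (Rel)
open import Relation.Binary.Structures using (IsStrictPartialOrder)
open import Relation.Nullary.Negation using (¬_; contradiction)
open import Relation.Unary using (Pred)
import Algebra.Apartness.Properties.HeytingCommutativeRing as HeytingProperties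
import Algebra.Definitions.RawMonoid as RawMonoidDefinitions
import Algebra.Properties.Ring as RingProperties
import Relation.Binary.Reasoning.Setoid as ≈-Reasoning

-- The real numbers, characterised as the Archimedean ordered field in which
-- the least upper bound principle holds.  The principle is in its constructive
-- form: it asks for subsets that are order-located.  Classically every subset
-- is order-located, so that this is the usual complete ordered field, which is
-- unique up to isomorphism.

record RealNumbers ℓ : Set (Level.suc ℓ) where
  infix 4 _<_ _≤_

  field
    heytingField : HeytingField ℓ ℓ ℓ

  open HeytingField heytingField public

  commutativeRing : CommutativeRing ℓ ℓ
  commutativeRing = record { isCommutativeRing = isCommutativeRing }

  open CommutativeRing commutativeRing public using (ring; +-rawMonoid)
  open RawMonoidDefinitions +-rawMonoid public using () renaming (_×_ to _·ℕ_)

  fromℕ : ℕ → Carrier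
  fromℕ n = n ·ℕ 1#

  field
    _<_                  : Rel Carrier ℓ
    isStrictPartialOrder : IsStrictPartialOrder _≈_ _<_
    <⇒#                  : ∀ {x y} → x < y → x # y
    #⇒<⊎>                : ∀ {x y} → x # y → x < y ⊎ y < x
    +-monoˡ-<            : ∀ z {x y} → x < y → x + z < y + z
    *-pos                : ∀ {x y} → 0# < x → 0# < y → 0# < x * y
    archimedean          : ∀ x → ∃[ n ] x < fromℕ n

  _≤_ : Rel Carrier ℓ
  x ≤ y = ¬ (y < x)

  UpperBound : Pred Carrier ℓ → Carrier → Set ℓ
  UpperBound P u = ∀ {x} → P x → x ≤ u

  Located : Pred Carrier ℓ → Set ℓ
  Located P = ∀ {x y} → x < y → (∃[ s ] P s × x < s) ⊎ UpperBound P y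

  IsSupremum : Pred Carrier ℓ → Carrier → Set ℓ
  IsSupremum P u = UpperBound P u × (∀ {x} → x < u → ∃[ s ] P s × x < s)

  field
    supremum : (P : Pred Carrier ℓ) → ∃[ x ] P x → ∃[ u ] UpperBound P u →
               Located P → ∃[ u ] IsSupremum P u

module Reals {ℓ} (ℝ : RealNumbers ℓ) where

  open RealNumbers ℝ public
  open HeytingProperties
    (HeytingField.heytingCommutativeRing heytingField) public
    using (1#0; x-0≈x)
  open RingProperties ring public
    using (-‿distribˡ-*; -‿distribʳ-*; -‿involutive)
  open IsStrictPartialOrder isStrictPartialOrder public
    using (<-respʳ-≈; <-respˡ-≈)
    renaming ( irrefl to <-irrefl; trans to <-trans )

  private variable
    x y z : Carrier

  <-cotrans : x < y → ∀ z → x < z ⊎ z < y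
  <-cotrans x<y z with #-cotrans (<⇒# x<y) z
  ... | inj₁ x#z = [ inj₁ , (λ z<x → inj₂ (<-trans z<x x<y)) ]′ (#⇒<⊎> x#z)
  ... | inj₂ z#y = [ inj₂ , (λ y<z → inj₁ (<-trans x<y y<z)) ]′ (#⇒<⊎> z#y)

  <-asym : x < y → ¬ (y < x)
  <-asym x<y y<x = <-irrefl refl (<-trans x<y y<x)

  +-monoʳ-< : ∀ z → x < y → z + x < z + y
  +-monoʳ-< z x<y =
    <-respʳ-≈ (+-comm _ z) (<-respˡ-≈ (+-comm _ z) (+-monoˡ-< z x<y))

  +-pos : 0# < x → 0# < y → 0# < x + y
  +-pos {x} 0<x 0<y = <-trans 0<x (<-respˡ-≈ (+-identityʳ x) (+-monoʳ-< x 0<y))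

  x<y⇒0<y-x : x < y → 0# < y - x
  x<y⇒0<y-x {x} x<y = <-respˡ-≈ (-‿inverseʳ x) (+-monoˡ-< (- x) x<y)

  y-x+x≈y : ∀ x y → (y - x) + x ≈ y
  y-x+x≈y x y = trans (+-assoc y (- x) x)
                 (trans (+-congˡ (-‿inverseˡ x)) (+-identityʳ y))

  0<y-x⇒x<y : 0# < y - x → x < y
  0<y-x⇒x<y {y} {x} 0<y-x =
    <-respʳ-≈ (y-x+x≈y x y) (<-respˡ-≈ (+-identityˡ x) (+-monoˡ-< x 0<y-x))

  0<1 : 0# < 1#
  0<1 with #⇒<⊎> 1#0
  ... | inj₂ 0<1 = 0<1
  ... | inj₁ 1<0 = <-respʳ-≈ [-1][-1]≈1 (*-pos 0<-1 0<-1)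
    where
    0<-1 : 0# < - 1#
    0<-1 = <-respʳ-≈ (+-identityˡ (- 1#)) (x<y⇒0<y-x 1<0)
    [-1][-1]≈1 : - 1# * - 1# ≈ 1#
    [-1][-1]≈1 = trans (sym (-‿distribˡ-* 1# (- 1#)))
                  (trans (-‿cong (*-identityˡ (- 1#))) (-‿involutive 1#))

  *-monoʳ-< : 0# < z → x < y → z * x < z * y
  *-monoʳ-< {z} {x} {y} 0<z x<y = 0<y-x⇒x<y (<-respʳ-≈ eq (*-pos 0<z (x<y⇒0<y-x x<y)))
    where
    eq : z * (y - x) ≈ z * y - z * x
    eq = trans (distribˡ z y (- x)) (+-congˡ (sym (-‿distribʳ-* z x)))

  *-monoˡ-< : 0# < z → x < y → x * z < y * z
  *-monoˡ-< {z} 0<z x<y =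
    <-respʳ-≈ (*-comm z _) (<-respˡ-≈ (*-comm z _) (*-monoʳ-< 0<z x<y))

  square-mono-< : 0# < x → x < y → x * x < y * y
  square-mono-< 0<x x<y = <-trans (*-monoʳ-< 0<x x<y) (*-monoˡ-< (<-trans 0<x x<y) x<y)

  0<fromℕ : ∀ n → 0# < fromℕ (suc n)
  0<fromℕ zero    = <-respʳ-≈ (sym (+-identityʳ 1#)) 0<1
  0<fromℕ (suc n) = +-pos 0<1 (0<fromℕ n)

  1/ : (n : ℕ) .{{_ : NonZero n}} → Carrier
  1/ (suc n) = proj₁ (#⇒invertible (#-sym (<⇒# (0<fromℕ n))))

  1/-inverseˡ : ∀ n → 1/ (suc n) * fromℕ (suc n) ≈ 1#
  1/-inverseˡ n with #⇒invertible (#-sym (<⇒# (0<fromℕ n)))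
  ... | _ , inverseˡ , _ = trans (*-congˡ (sym (x-0≈x (fromℕ (suc n))))) inverseˡ

  infixl 7 _/_

  _/_ : Carrier → (n : ℕ) .{{_ : NonZero n}} → Carrier
  x / n = x * 1/ n

  fromℤ : ℤ → Carrier
  fromℤ (+ n)    = fromℕ n
  fromℤ -[1+ n ] = - fromℕ (suc n)

  fromℚ : ℚ → Carrier
  fromℚ p = fromℤ (ℚ.↥ p) / ℚ.↧ₙ p

  2x≈x+x : ∀ x → fromℕ 2 * x ≈ x + x
  2x≈x+x x = begin
    (1# + (1# + 0#)) * x  ≈⟨ *-congʳ (+-congˡ (+-identityʳ 1#)) ⟩
    (1# + 1#) * x         ≈⟨ distribʳ x 1# 1# ⟩
    1# * x + 1# * x       ≈⟨ +-cong (*-identityˡ x) (*-identityˡ x) ⟩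
    x + x                 ∎
    where open ≈-Reasoning setoid

  x/2+x/2≈x : ∀ x → x / 2 + x / 2 ≈ x
  x/2+x/2≈x x = begin
    x / 2 + x / 2              ≈⟨ distribˡ x (1/ 2) (1/ 2) ⟨
    x * (1/ 2 + 1/ 2)          ≈⟨ *-congˡ (2x≈x+x (1/ 2)) ⟨
    x * (fromℕ 2 * 1/ 2)       ≈⟨ *-congˡ (*-comm (fromℕ 2) (1/ 2)) ⟩
    x * (1/ 2 * fromℕ 2)       ≈⟨ *-congˡ (1/-inverseˡ 1) ⟩
    x * 1#                     ≈⟨ *-identityʳ x ⟩
    x                          ∎
    where open ≈-Reasoning setoid

  0<x⇒0<x/2 : 0# < x → 0# < x / 2
  0<x⇒0<x/2 {x} 0<x with <-cotrans 0<x (x / 2)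
  ... | inj₁ 0<x/2 = 0<x/2
  ... | inj₂ x/2<x = <-respʳ-≈ eq (x<y⇒0<y-x x/2<x)
    where
    open ≈-Reasoning setoid
    eq : x - x / 2 ≈ x / 2
    eq = begin
      x - x / 2               ≈⟨ +-congʳ (x/2+x/2≈x x) ⟨
      (x / 2 + x / 2) - x / 2 ≈⟨ +-assoc _ _ _ ⟩
      x / 2 + (x / 2 - x / 2) ≈⟨ +-congˡ (-‿inverseʳ (x / 2)) ⟩
      x / 2 + 0#              ≈⟨ +-identityʳ _ ⟩
      x / 2                   ∎

  <-dense : x < y → ∃[ z ] x < z × z < y
  <-dense {x} {y} x<y = d + x ,
    <-respˡ-≈ (+-identityˡ x) (+-monoˡ-< x 0<d) ,
    <-respʳ-≈ eq (<-respˡ-≈ (+-identityˡ (d + x)) (+-monoˡ-< (d + x) 0<d))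
    where
    d   = (y - x) / 2
    0<d = 0<x⇒0<x/2 (x<y⇒0<y-x x<y)
    eq : d + (d + x) ≈ y
    eq = trans (sym (+-assoc d d x))
          (trans (+-congʳ (x/2+x/2≈x (y - x))) (y-x+x≈y x y))

  BelowSqrt : Carrier → Pred Carrier ℓ
  BelowSqrt a x = x ≤ 0# ⊎ x * x < a

  belowSqrt-≤ : ∀ {a} → 0# < y → a < y * y → UpperBound (BelowSqrt a) y
  belowSqrt-≤ 0<y a<yy (inj₁ x≤0)  y<x = x≤0 (<-trans 0<y y<x)
  belowSqrt-≤ 0<y a<yy (inj₂ xx<a) y<x =
    <-asym (<-trans xx<a a<yy) (square-mono-< 0<y y<x)

  belowSqrt-bounded : ∀ a → ∃[ u ] UpperBound (BelowSqrt a) u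
  belowSqrt-bounded a with <-cotrans 0<1 a
  ... | inj₂ a<1 = 1# , belowSqrt-≤ 0<1 (<-respʳ-≈ (sym (*-identityˡ 1#)) a<1)
  ... | inj₁ 0<a = a + 1# , belowSqrt-≤ 0<a+1 (<-trans a<a+1 a+1<[a+1]²)
    where
    a<a+1 : a < a + 1#
    a<a+1 = <-respˡ-≈ (+-identityʳ a) (+-monoʳ-< a 0<1)
    0<a+1 : 0# < a + 1#
    0<a+1 = <-trans 0<a a<a+1
    a+1<[a+1]² : a + 1# < (a + 1#) * (a + 1#)
    a+1<[a+1]² = <-respˡ-≈ (*-identityʳ (a + 1#))
      (*-monoʳ-< 0<a+1 (<-respˡ-≈ (+-identityˡ 1#) (+-monoˡ-< 1# 0<a)))

  belowSqrt-located : ∀ a → Located (BelowSqrt a)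
  belowSqrt-located a {x} {y} x<y with <-dense x<y
  ... | t , x<t , t<y with <-cotrans x<t 0#
  ...   | inj₁ x<0 = inj₁ (0# , inj₁ (<-irrefl refl) , x<0)
  ...   | inj₂ 0<t with <-cotrans (square-mono-< 0<t t<y) a
  ...     | inj₁ tt<a = inj₁ (t , inj₂ tt<a , x<t)
  ...     | inj₂ a<yy = inj₂ (belowSqrt-≤ (<-trans 0<t t<y) a<yy)

  -- The supremum of { x ∣ x ≤ 0 or x² < a }: the nonnegative square root of a
  -- when 0 ≤ a, and 0 when a < 0.

  √ : Carrier → Carrier
  √ a = proj₁ (supremum (BelowSqrt a) (0# , inj₁ (<-irrefl refl))
                 (belowSqrt-bounded a) (belowSqrt-located a))

  infix  4 _≈ᶜ_
  infixl 6 _+ᶜ_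
  infixl 7 _*ᶜ_

  record ℂ : Set ℓ where
    constructor _+i_
    field
      re im : Carrier

  open ℂ public

  _≈ᶜ_ : Rel ℂ ℓ
  w ≈ᶜ z = re w ≈ re z × im w ≈ im z

  _+ᶜ_ _*ᶜ_ : ℂ → ℂ → ℂ
  w +ᶜ z = (re w + re z) +i (im w + im z)
  w *ᶜ z = (re w * re z - im w * im z) +i (re w * im z + im w * re z)

  ofReal : Carrier → ℂ
  ofReal x = x +i 0#

  ∣_∣ : ℂ → Carrier
  ∣ z ∣ = √ (re z * re z + im z * im z)

  -- A vector a₀ ∷ … ∷ aₙ₋₁ ∷ [] stands for the monic polynomial of degree n
  -- a₀ + a₁ X + … + aₙ₋₁ Xⁿ⁻¹ + Xⁿ, with the leading coefficient left out.

  evalMonic : ∀ {n} → Vec ℂ n → ℂ → ℂ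
  evalMonic []       z = ofReal 1#
  evalMonic (a ∷ as) z = a +ᶜ z *ᶜ evalMonic as z

  IsRootℚ : ∀ {n} → Vec ℚ n → ℂ → Set ℓ
  IsRootℚ p z = evalMonic (Vec.map (λ a → ofReal (fromℚ a)) p) z ≈ᶜ ofReal 0#

  IsRootℤ : ∀ {n} → Vec ℤ n → ℂ → Set ℓ
  IsRootℤ p z = evalMonic (Vec.map (λ a → ofReal (fromℤ a)) p) z ≈ᶜ ofReal 0#

  IsMinimalPolynomial : ∀ {n} → Vec ℚ n → ℂ → Set ℓ
  IsMinimalPolynomial {n} p α =
    IsRootℚ p α × (∀ {k} (r : Vec ℚ k) → IsRootℚ r α → n ℕ.≤ k)

  IsGaloisConjugate : ℂ → ℂ → Set ℓ
  IsGaloisConjugate α β =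
    ∃[ n ] Σ[ p ∈ Vec ℚ n ] IsMinimalPolynomial p α × IsRootℚ p β

  IsAlgebraicInteger : ℂ → Set ℓ
  IsAlgebraicInteger α = ∃[ n ] Σ[ p ∈ Vec ℤ n ] IsRootℤ p α

  IsPisot : Carrier → Set ℓ
  IsPisot q = 1# < q × IsAlgebraicInteger (ofReal q) ×
    (∀ z → IsGaloisConjugate (ofReal q) z → ¬ (z ≈ᶜ ofReal q) → ∣ z ∣ < 1#)

  IsFloor : ℕ → Carrier → Set ℓ
  IsFloor a x = fromℕ a ≤ x × x < fromℕ (suc a)

  -- Each digit is the integer part of q x, and the next point of the orbit is
  -- q x mod 1.  The orbit has to reach 0 for the digit list to end.

  data GreedyExpansion (q : Carrier) : Carrier → List ℕ → Set ℓ where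
    done  : ∀ {x} → x ≈ 0# → GreedyExpansion q x []
    digit : ∀ {x a as} → IsFloor a (q * x) → GreedyExpansion q (q * x - fromℕ a) as →
            GreedyExpansion q x (a ∷ as)

  IsSimpleParry : Carrier → Set ℓ
  IsSimpleParry q = 1# < q × (∃[ as ] GreedyExpansion q 1# as)

  -- X⁴ - 3X³ + X² - 2X - 1

  quartic : Vec ℤ 4
  quartic = ℤ.-1ℤ ∷ -[1+ 1 ] ∷ + 1 ∷ -[1+ 2 ] ∷ []

  IsRootOfMinimalModulus : ∀ {n} → Vec ℤ n → ℂ → Set ℓ
  IsRootOfMinimalModulus p z = IsRootℤ p z × (∀ w → IsRootℤ p w → ∣ z ∣ ≤ ∣ w ∣)

  -- Is-c m x says that x is the constant cₘ, for m ≥ 1.  It is a relation since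
  -- c₂ is given through a root of a polynomial; it determines x up to _≈_.
  -- The last clause is meant for m ≥ 3; at m = 0 it has no significance.

  Is-c : ℕ → Carrier → Set ℓ
  Is-c 1 x = x ≈ (√ (fromℕ 5) - 1#) / 2
  Is-c 2 x = ∃[ z ] IsRootOfMinimalModulus quartic z × x ≈ ∣ z ∣
  Is-c m x = x ≈ (fromℕ (m ℕ.+ 1) - √ (fromℕ (m ℕ.^ 2 ℕ.+ 2 ℕ.* m) - fromℕ 3)) / 2

{-# OPTIONS --safe #-}
module Submission where

-- Let y₀ = 1, yᵢ₊₁ = q′ yᵢ - aᵢ₊₁ be the orbit of 1 under the greedy digits
-- a₁ … aₙ of q, with aₙ ≥ 1; then yₙ = 0, since yₙ is an integer polynomial in
-- q′ that vanishes at q.  Put r = |q′| and suppose D = 1 - m r - r² > 0.  The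
-- digits lie in [0, m], so (1 - r) |yᵢ| ≤ m.  Their differences lie in [-m, m],
-- and yᵢ₊₁ - yᵢ = q′ (yᵢ - yᵢ₋₁) - (aᵢ₊₁ - aᵢ), so (1 - r) |yᵢ - yᵢ₋₁| ≤ m + D.
-- If aₙ₋₁ = 0, the first bound contradicts q′² yₙ₋₂ = aₙ; otherwise
-- |aₙ - aₙ₋₁| ≤ m - 1, and the second one contradicts
-- q′² (yₙ₋₁ - yₙ₋₂) = q′ (aₙ - aₙ₋₁) - aₙ.  Hence r² + m r ≥ 1 for every
-- conjugate, real or not, which is the bound (√(m² + 4) - m) / 2 ≤ r.

open import Defs
open import Algebra.Bundles using (CommutativeRing)
open import Algebra.Solver.Ring.AlmostCommutativeRing
  using (fromCommutativeRing; _-Raw-AlmostCommutative⟶_)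
open import Data.Empty using (⊥)
open import Data.Integer.Base as ℤ using (ℤ; +_; -[1+_]; _⊖_)
import Data.Integer.Properties as ℤ
open import Data.List.Base using (List; []; _∷_)
open import Data.List.Relation.Unary.All using (All; []; _∷_)
open import Data.Maybe.Base using (just; nothing)
open import Data.Nat.Base as ℕ using (ℕ; zero; suc; z≤n; s≤s)
open import Data.Nat.Induction using (<-wellFounded)
import Data.Nat.Properties as ℕ
open import Data.Product.Base using (_×_; _,_; proj₁; proj₂; ∃-syntax; Σ-syntax)
open import Data.Rational.Base as ℚ using (ℚ; 0ℚ; toℚᵘ)
open import Data.Rational.Literals using () renaming (fromℤ to toℚ)
import Data.Rational.Properties as ℚ
open import Data.Rational.Unnormalised.Base as ℚᵘ using (ℚᵘ; mkℚᵘ; *≡*)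
  renaming (↥_ to ↥ᵘ_; ↧_ to ↧ᵘ_)
open import Data.Sum.Base using (_⊎_; inj₁; inj₂; [_,_]′)
open import Data.Vec.Base as Vec using (Vec; []; _∷_)
open import Induction.WellFounded using (Acc; acc)
open import Relation.Binary.Definitions using (WeaklyDecidable)
open import Relation.Binary.PropositionalEquality.Core as ≡ using (_≡_)
open import Relation.Nullary.Decidable.Core using (yes; no)
open import Relation.Nullary.Negation using (¬_; contradiction)
open import Relation.Unary using (Pred)
import Algebra.Properties.AbelianGroup as AbelianGroupProperties
import Algebra.Properties.Ring as RingProperties
import Algebra.Properties.Semiring.Mult as Mult
import Algebra.Properties.Semiring.Mult.TCOptimised as TCMult
import Algebra.Solver.Ring as RingSolver
import Relation.Binary.Reasoning.Setoid as ≈-Reasoning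

-- Bounding the |yᵢ| alone is too weak: q′ yₙ₋₁ = aₙ ≥ 1 only gives m r ≥ 1 - r, that is r ≥ 1 / (m
-- + 1). The gain comes from aₙ - aₙ₋₁, which loses a unit against m once both digits are at least
-- 1. The constant m + D is dictated by the start of the orbit: |y₁ - y₀| ≤ r + m + 1, and (1 - r)
-- (r + m + 1) = m + D exactly. The relation ≤ is the negation of <, so every bound is proved by
-- refuting a strict inequality. With b the positive root of X² + m X - 1, the assumption r < b
-- gives D = (b - r) (b + r + m) > 0. It remains to compare cₘ with b. They coincide for m = 1; for
-- m = 2 the quartic has a real root in [-b, 0]; for m ≥ 3 the square roots are removed by squaring.

-- A ring solver with integer constants over any commutative ring.

-- The optimised multiples are used so that the solver's constant 1 is 1# and
-- not 1# + 0#.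
module IntegerCoefficients {c ℓ} (A : CommutativeRing c ℓ) where

  open CommutativeRing A
  open RingProperties ring
  open AbelianGroupProperties +-abelianGroup using (⁻¹-∙-comm; ε⁻¹≈ε)
  open TCMult semiring using (×-homo-+; ×1-homo-*; 1+×) renaming (_×_ to _·_)
  open ≈-Reasoning setoid

  ofℤ : ℤ → Carrier
  ofℤ (+ n)    = n · 1#
  ofℤ -[1+ n ] = - (suc n · 1#)

  ofℤ-⊖ : ∀ m n → ofℤ (m ⊖ n) ≈ m · 1# - n · 1#
  ofℤ-⊖ m zero = sym (trans (+-congˡ ε⁻¹≈ε) (+-identityʳ _))
  ofℤ-⊖ zero (suc n) = sym (+-identityˡ _)
  ofℤ-⊖ (suc m) (suc n) = begin
    ofℤ (suc m ⊖ suc n)                  ≡⟨ ≡.cong ofℤ (ℤ.[1+m]⊖[1+n]≡m⊖n m n) ⟩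
    ofℤ (m ⊖ n)                          ≈⟨ ofℤ-⊖ m n ⟩
    a - b                                ≈⟨ +-identityˡ _ ⟨
    0# + (a - b)                         ≈⟨ +-congʳ (-‿inverseʳ 1#) ⟨
    (1# - 1#) + (a - b)                  ≈⟨ +-assoc _ _ _ ⟩
    1# + (- 1# + (a - b))                ≈⟨ +-congˡ (+-comm _ _) ⟩
    1# + ((a - b) - 1#)                  ≈⟨ +-congˡ (+-assoc _ _ _) ⟩
    1# + (a + (- b - 1#))                ≈⟨ +-assoc _ _ _ ⟨
    (1# + a) + (- b - 1#)                ≈⟨ +-congˡ (⁻¹-∙-comm b 1#) ⟩
    (1# + a) - (b + 1#)
      ≈⟨ +-cong (sym (1+× m 1#)) (-‿cong (trans (+-comm b 1#) (sym (1+× n 1#)))) ⟩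
    suc m · 1# - suc n · 1#              ∎
    where
    a = m · 1#
    b = n · 1#

  ofℤ-homo-neg : ∀ i → ofℤ (ℤ.- i) ≈ - ofℤ i
  ofℤ-homo-neg (+ zero)  = sym ε⁻¹≈ε
  ofℤ-homo-neg (+ suc n) = refl
  ofℤ-homo-neg -[1+ n ]  = sym (-‿involutive _)

  ofℤ-homo-+ : ∀ i j → ofℤ (i ℤ.+ j) ≈ ofℤ i + ofℤ j
  ofℤ-homo-+ (+ m) (+ n)       = ×-homo-+ 1# m n
  ofℤ-homo-+ (+ m) -[1+ n ]    = ofℤ-⊖ m (suc n)
  ofℤ-homo-+ -[1+ m ] (+ n)    = trans (ofℤ-⊖ n (suc m)) (+-comm _ _)
  ofℤ-homo-+ -[1+ m ] -[1+ n ] = begin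
    - (suc (suc (m ℕ.+ n)) · 1#)     ≈⟨ -‿cong (1+× (suc (m ℕ.+ n)) 1#) ⟩
    - (1# + (suc m ℕ.+ n) · 1#)      ≈⟨ -‿cong (+-congˡ (×-homo-+ 1# (suc m) n)) ⟩
    - (1# + (a + b))                 ≈⟨ -‿cong (+-assoc _ _ _) ⟨
    - ((1# + a) + b)                 ≈⟨ -‿cong (+-congʳ (+-comm 1# a)) ⟩
    - ((a + 1#) + b)                 ≈⟨ -‿cong (+-assoc _ _ _) ⟩
    - (a + (1# + b))                 ≈⟨ -‿cong (+-congˡ (1+× n 1#)) ⟨
    - (a + suc n · 1#)               ≈⟨ ⁻¹-∙-comm a _ ⟨
    - a - suc n · 1#                 ∎
    where
    a = suc m · 1#
    b = n · 1#

  ofℤ-homo-* : ∀ i j → ofℤ (i ℤ.* j) ≈ ofℤ i * ofℤ j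
  ofℤ-homo-* (+ m) (+ n) = trans (reflexive (≡.cong ofℤ (≡.sym (ℤ.pos-* m n)))) (×1-homo-* m n)
  ofℤ-homo-* (+ m) -[1+ n ] = begin
    ofℤ (+ m ℤ.* (ℤ.- + suc n))     ≡⟨ ≡.cong ofℤ (ℤ.neg-distribʳ-* (+ m) (+ suc n)) ⟨
    ofℤ (ℤ.- (+ m ℤ.* + suc n))     ≈⟨ ofℤ-homo-neg (+ m ℤ.* + suc n) ⟩
    - ofℤ (+ m ℤ.* + suc n)         ≈⟨ -‿cong (ofℤ-homo-* (+ m) (+ suc n)) ⟩
    - (m · 1# * suc n · 1#)         ≈⟨ -‿distribʳ-* _ _ ⟩
    m · 1# * - (suc n · 1#)         ∎
  ofℤ-homo-* -[1+ m ] (+ n) = begin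
    ofℤ ((ℤ.- + suc m) ℤ.* + n)     ≡⟨ ≡.cong ofℤ (ℤ.neg-distribˡ-* (+ suc m) (+ n)) ⟨
    ofℤ (ℤ.- (+ suc m ℤ.* + n))     ≈⟨ ofℤ-homo-neg (+ suc m ℤ.* + n) ⟩
    - ofℤ (+ suc m ℤ.* + n)         ≈⟨ -‿cong (ofℤ-homo-* (+ suc m) (+ n)) ⟩
    - (suc m · 1# * n · 1#)         ≈⟨ -‿distribˡ-* _ _ ⟩
    - (suc m · 1#) * n · 1#         ∎
  ofℤ-homo-* -[1+ m ] -[1+ n ] = begin
    (suc m ℕ.* suc n) · 1#                ≈⟨ ×1-homo-* (suc m) (suc n) ⟩
    suc m · 1# * suc n · 1#               ≈⟨ -‿involutive _ ⟨
    - - (suc m · 1# * suc n · 1#)         ≈⟨ -‿cong (-‿distribʳ-* _ _) ⟩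
    - (suc m · 1# * - (suc n · 1#))       ≈⟨ -‿distribˡ-* _ _ ⟩
    - (suc m · 1#) * - (suc n · 1#)       ∎

  ofℤ-morphism : ℤ.+-*-rawRing -Raw-AlmostCommutative⟶ fromCommutativeRing A
  ofℤ-morphism = record
    { ⟦_⟧    = ofℤ
    ; +-homo = ofℤ-homo-+
    ; *-homo = ofℤ-homo-*
    ; -‿homo = ofℤ-homo-neg
    ; 0-homo = refl
    ; 1-homo = refl
    }

  ofℤ≟ : WeaklyDecidable (λ i j → ofℤ i ≈ ofℤ j)
  ofℤ≟ i j with i ℤ.≟ j
  ... | yes i≡j = just (reflexive (≡.cong ofℤ i≡j))
  ... | no  _   = nothing

  open RingSolver ℤ.+-*-rawRing (fromCommutativeRing A) ofℤ-morphism ofℤ≟ public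
    using (solve; con; _:=_; _:+_; _:*_; _:-_; :-_)

-- Order and arithmetic of the reals, with ≤ as a negated <.

module OrderedField {ℓ} (ℝ : RealNumbers ℓ) where
  open Reals ℝ
  open IntegerCoefficients commutativeRing public

  private variable
    x y z w : Carrier

  ≤-refl : x ≤ x
  ≤-refl = <-irrefl refl

  ≤-reflexive : x ≈ y → x ≤ y
  ≤-reflexive x≈y = <-irrefl (sym x≈y)

  <⇒≤ : x < y → x ≤ y
  <⇒≤ = <-asym

  ≤-trans : x ≤ y → y ≤ z → x ≤ z
  ≤-trans {y = y} x≤y y≤z z<x with <-cotrans z<x y
  ... | inj₁ z<y = y≤z z<y
  ... | inj₂ y<x = x≤y y<x

  ≤-<-trans : x ≤ y → y < z → x < z
  ≤-<-trans {x} x≤y y<z with <-cotrans y<z x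
  ... | inj₁ y<x = contradiction y<x x≤y
  ... | inj₂ x<z = x<z

  <-≤-trans : x < y → y ≤ z → x < z
  <-≤-trans {z = z} x<y y≤z with <-cotrans x<y z
  ... | inj₁ x<z = x<z
  ... | inj₂ z<y = contradiction z<y y≤z

  ≤-respʳ-≈ : y ≈ z → x ≤ y → x ≤ z
  ≤-respʳ-≈ y≈z x≤y = ≤-trans x≤y (≤-reflexive y≈z)

  ≤-respˡ-≈ : y ≈ z → y ≤ x → z ≤ x
  ≤-respˡ-≈ y≈z y≤x = ≤-trans (≤-reflexive (sym y≈z)) y≤x

  ≤-antisym : x ≤ y → y ≤ x → x ≈ y
  ≤-antisym x≤y y≤x = proj₁ (tight _ _) λ x#y → [ y≤x , x≤y ]′ (#⇒<⊎> x#y)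

  -- Trichotomy is not decidable constructively, but tightness of apartness yields its double
  -- negation, which is enough whenever the goal is itself a negation, such as ≤.
  <-tri : ¬ ¬ (x < y ⊎ x ≈ y ⊎ y < x)
  <-tri ¬tri = ¬tri (inj₂ (inj₁ (≤-antisym (λ y<x → ¬tri (inj₂ (inj₂ y<x)))
                                            (λ x<y → ¬tri (inj₁ x<y)))))

  0≤y-x⇒x≤y : 0# ≤ y - x → x ≤ y
  0≤y-x⇒x≤y {y} {x} 0≤y-x y<x = 0≤y-x
    (<-respʳ-≈ (-‿inverseʳ x) (+-monoˡ-< (- x) y<x))

  x≤y⇒0≤y-x : x ≤ y → 0# ≤ y - x
  x≤y⇒0≤y-x {x} {y} x≤y y-x<0 = x≤y
    (<-respˡ-≈ (y-x+x≈y x y) (<-respʳ-≈ (+-identityˡ x) (+-monoˡ-< x y-x<0)))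

  +-nonneg : 0# ≤ x → 0# ≤ y → 0# ≤ x + y
  +-nonneg {x} {y} 0≤x 0≤y x+y<0 with <-cotrans x+y<0 x
  ... | inj₁ x+y<x = 0≤y (<-respˡ-≈ eq (<-respʳ-≈ (-‿inverseˡ x) (+-monoʳ-< (- x) x+y<x)))
    where
    eq : - x + (x + y) ≈ y
    eq = solve 2 (λ x y → :- x :+ (x :+ y) := y) refl x y
  ... | inj₂ x<0   = 0≤x x<0

  +-pos-nonneg : 0# < x → 0# ≤ y → 0# < x + y
  +-pos-nonneg {x} {y} 0<x 0≤y = <-≤-trans 0<x
    (0≤y-x⇒x≤y (≤-respʳ-≈ (solve 2 (λ x y → y := (x :+ y) :- x) refl x y) 0≤y))

  *-nonneg : 0# ≤ x → 0# ≤ y → 0# ≤ x * y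
  *-nonneg {x} {y} 0≤x 0≤y xy<0 = <-tri λ where
    (inj₁ x<0)        → 0≤x x<0
    (inj₂ (inj₁ x≈0)) → <-irrefl (trans (*-congʳ x≈0) (zeroˡ y)) xy<0
    (inj₂ (inj₂ 0<x)) → <-tri λ where
      (inj₁ y<0)        → 0≤y y<0
      (inj₂ (inj₁ y≈0)) → <-irrefl (trans (*-congˡ y≈0) (zeroʳ x)) xy<0
      (inj₂ (inj₂ 0<y)) → <-asym (*-pos 0<x 0<y) xy<0

  square-nonneg : ∀ x → 0# ≤ x * x
  square-nonneg x xx<0 = <-tri λ where
    (inj₁ x<0)        → <-asym xx<0 (<-respʳ-≈ (solve 1 (λ x → (con (+ 0) :- x) :* (con (+ 0) :- x)
                                                    := x :* x) refl x)
                          (*-pos (x<y⇒0<y-x x<0) (x<y⇒0<y-x x<0)))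
    (inj₂ (inj₁ x≈0)) → <-irrefl (trans (*-congʳ x≈0) (zeroˡ x)) xx<0
    (inj₂ (inj₂ 0<x)) → <-asym xx<0 (*-pos 0<x 0<x)

  ≤-by : y - x ≈ w → 0# ≤ w → x ≤ y
  ≤-by y-x≈w 0≤w = 0≤y-x⇒x≤y (≤-respʳ-≈ (sym y-x≈w) 0≤w)

  <-by : y - x ≈ w → 0# < w → x < y
  <-by y-x≈w 0<w = 0<y-x⇒x<y (<-respʳ-≈ (sym y-x≈w) 0<w)

  +-mono-≤ : x ≤ y → z ≤ w → x + z ≤ y + w
  +-mono-≤ {x} {y} {z} {w} x≤y z≤w = ≤-by
    (solve 4 (λ x y z w → (y :+ w) :- (x :+ z) := (y :- x) :+ (w :- z)) refl x y z w)
    (+-nonneg (x≤y⇒0≤y-x x≤y) (x≤y⇒0≤y-x z≤w))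

  *-mono-≤ : 0# ≤ z → 0# ≤ y → x ≤ y → z ≤ w → x * z ≤ y * w
  *-mono-≤ {z} {y} {x} {w} 0≤z 0≤y x≤y z≤w = ≤-by
    (solve 4 (λ x y z w → y :* w :- x :* z := (y :- x) :* z :+ y :* (w :- z)) refl x y z w)
    (+-nonneg (*-nonneg (x≤y⇒0≤y-x x≤y) 0≤z) (*-nonneg 0≤y (x≤y⇒0≤y-x z≤w)))

  square-cancel-≤ : 0# ≤ y → x * x ≤ y * y → x ≤ y
  square-cancel-≤ {y} {x} 0≤y xx≤yy y<x = xx≤yy (<-by
    (solve 2 (λ x y → x :* x :- y :* y := (x :- y) :* ((x :- y) :+ (y :+ y))) refl x y)
    (*-pos 0<x-y (+-pos-nonneg 0<x-y (+-nonneg 0≤y 0≤y))))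
    where 0<x-y = x<y⇒0<y-x y<x

  0≤1 : 0# ≤ 1#
  0≤1 = <⇒≤ 0<1

  0≤fromℕ : ∀ n → 0# ≤ fromℕ n
  0≤fromℕ zero    = ≤-refl
  0≤fromℕ (suc n) = <⇒≤ (0<fromℕ n)

  fromℕ-mono-≤ : ∀ {m n} → m ℕ.≤ n → fromℕ m ≤ fromℕ n
  fromℕ-mono-≤ {n = n} z≤n = 0≤fromℕ n
  fromℕ-mono-≤ (s≤s m≤n) = +-mono-≤ ≤-refl (fromℕ-mono-≤ m≤n)

  1≤fromℕ : ∀ {n} → 1 ℕ.≤ n → 1# ≤ fromℕ n
  1≤fromℕ {n} 1≤n = ≤-respˡ-≈ (+-identityʳ 1#) (fromℕ-mono-≤ {1} {n} 1≤n)

-- The ring of complex numbers, and discs around 0.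

module Complex {ℓ} (ℝ : RealNumbers ℓ) where
  open Reals ℝ
  open OrderedField ℝ

  -ᶜ_ : ℂ → ℂ
  -ᶜ z = (- re z) +i (- im z)

  ℂ-commutativeRing : CommutativeRing ℓ ℓ
  ℂ-commutativeRing = record
    { Carrier = ℂ
    ; _≈_ = _≈ᶜ_
    ; _+_ = _+ᶜ_
    ; _*_ = _*ᶜ_
    ; -_  = -ᶜ_
    ; 0#  = ofReal 0#
    ; 1#  = ofReal 1#
    ; isCommutativeRing = record
      { isRing = record
        { +-isAbelianGroup = record
          { isGroup = record
            { isMonoid = record
              { isSemigroup = record
                { isMagma = record
                  { isEquivalence = record
                    { refl  = refl , refl
                    ; sym   = λ (p , q) → sym p , sym q
                    ; trans = λ (p , q) (p′ , q′) → trans p p′ , trans q q′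
                    }
                  ; ∙-cong = λ (p , q) (p′ , q′) → +-cong p p′ , +-cong q q′
                  }
                ; assoc = λ _ _ _ → +-assoc _ _ _ , +-assoc _ _ _
                }
              ; identity = (λ _ → +-identityˡ _ , +-identityˡ _) , (λ _ → +-identityʳ _ , +-identityʳ _)
              }
            ; inverse = (λ _ → -‿inverseˡ _ , -‿inverseˡ _) , (λ _ → -‿inverseʳ _ , -‿inverseʳ _)
            ; ⁻¹-cong = λ (p , q) → -‿cong p , -‿cong q
            }
          ; comm = λ _ _ → +-comm _ _ , +-comm _ _
          }
        ; *-cong = λ (p , q) (p′ , q′) →
            +-cong (*-cong p p′) (-‿cong (*-cong q q′)) , +-cong (*-cong p q′) (*-cong q p′)
        ; *-assoc = λ (a +i b) (c +i d) (e +i f) →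
            solve 6 (λ a b c d e f → (a :* c :- b :* d) :* e :- (a :* d :+ b :* c) :* f
                                  := a :* (c :* e :- d :* f) :- b :* (c :* f :+ d :* e))
                                  refl a b c d e f ,
            solve 6 (λ a b c d e f → (a :* c :- b :* d) :* f :+ (a :* d :+ b :* c) :* e
                                  := a :* (c :* f :+ d :* e) :+ b :* (c :* e :- d :* f))
                                  refl a b c d e f
        ; *-identity =
            (λ (a +i b) →
              solve 2 (λ a b → con (+ 1) :* a :- con (+ 0) :* b := a) refl a b ,
              solve 2 (λ a b → con (+ 1) :* b :+ con (+ 0) :* a := b) refl a b) ,
            (λ (a +i b) →
              solve 2 (λ a b → a :* con (+ 1) :- b :* con (+ 0) := a) refl a b ,
              solve 2 (λ a b → a :* con (+ 0) :+ b :* con (+ 1) := b) refl a b)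
        ; distrib =
            (λ (a +i b) (c +i d) (e +i f) →
              solve 6 (λ a b c d e f → a :* (c :+ e) :- b :* (d :+ f)
                                    := (a :* c :- b :* d) :+ (a :* e :- b :* f)) refl a b c d e f ,
              solve 6 (λ a b c d e f → a :* (d :+ f) :+ b :* (c :+ e)
                                    := (a :* d :+ b :* c) :+ (a :* f :+ b :* e)) refl a b c d e f) ,
            (λ (a +i b) (c +i d) (e +i f) →
              solve 6 (λ a b c d e f → (c :+ e) :* a :- (d :+ f) :* b
                                    := (c :* a :- d :* b) :+ (e :* a :- f :* b)) refl a b c d e f ,
              solve 6 (λ a b c d e f → (c :+ e) :* b :+ (d :+ f) :* a
                                    := (c :* b :+ d :* a) :+ (e :* b :+ f :* a)) refl a b c d e f)
        }
      ; *-comm = λ (a +i b) (c +i d) →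
          solve 4 (λ a b c d → a :* c :- b :* d := c :* a :- d :* b) refl a b c d ,
          solve 4 (λ a b c d → a :* d :+ b :* c := c :* b :+ d :* a) refl a b c d
      }
    }

  module ℂ-Ring = CommutativeRing ℂ-commutativeRing
  module ℂ-Solver = IntegerCoefficients ℂ-commutativeRing

  ofReal-homo-* : ∀ x y → ofReal (x * y) ≈ᶜ ofReal x *ᶜ ofReal y
  ofReal-homo-* x y =
    solve 2 (λ x y → x :* y := x :* y :- con (+ 0) :* con (+ 0)) refl x y ,
    solve 2 (λ x y → con (+ 0) := x :* con (+ 0) :+ con (+ 0) :* y) refl x y

  ofReal-homo-+ : ∀ x y → ofReal (x + y) ≈ᶜ ofReal x +ᶜ ofReal y
  ofReal-homo-+ x y = refl , sym (+-identityʳ 0#)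

  ofReal-homo-neg : ∀ x → ofReal (- x) ≈ᶜ -ᶜ ofReal x
  ofReal-homo-neg x = refl , solve 0 (con (+ 0) := :- con (+ 0)) refl

  normSq : ℂ → Carrier
  normSq z = re z * re z + im z * im z

  -- The bound |z| ≤ s in squared form: no square root occurs, and closure under sums and products
  -- reduces to polynomial identities.
  InDisc : Carrier → ℂ → Set ℓ
  InDisc s z = 0# ≤ s × normSq z ≤ s * s

  private variable
    s t : Carrier
    w z : ℂ

  normSq-nonneg : ∀ z → 0# ≤ normSq z
  normSq-nonneg z = +-nonneg (square-nonneg (re z)) (square-nonneg (im z))

  normSq-* : ∀ w z → normSq (w *ᶜ z) ≈ normSq w * normSq z
  normSq-* (a +i b) (c +i d) = solve 4 (λ a b c d →
      (a :* c :- b :* d) :* (a :* c :- b :* d) :+ (a :* d :+ b :* c) :* (a :* d :+ b :* c)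
    := (a :* a :+ b :* b) :* (c :* c :+ d :* d)) refl a b c d

  normSq-≤-* : InDisc s w → InDisc t z → normSq w * normSq z ≤ (s * t) * (s * t)
  normSq-≤-* {s} {w} {t} {z} (0≤s , w≤s) (0≤t , z≤t) =
    ≤-respʳ-≈ (solve 2 (λ s t → (s :* s) :* (t :* t) := (s :* t) :* (s :* t)) refl s t)
      (*-mono-≤ (normSq-nonneg z) (*-nonneg 0≤s 0≤s) w≤s z≤t)

  inDisc-resp-≈ : w ≈ᶜ z → InDisc s w → InDisc s z
  inDisc-resp-≈ (p , q) (0≤s , w≤s) =
    0≤s , ≤-respˡ-≈ (+-cong (*-cong p p) (*-cong q q)) w≤s

  inDisc-mono : s ≤ t → InDisc s z → InDisc t z
  inDisc-mono s≤t (0≤s , z≤s) =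
    0≤t , ≤-trans z≤s (*-mono-≤ 0≤s 0≤t s≤t s≤t)
    where 0≤t = ≤-trans 0≤s s≤t

  inDisc-* : InDisc s w → InDisc t z → InDisc (s * t) (w *ᶜ z)
  inDisc-* {w = w} {z = z} w∈ z∈ =
    *-nonneg (proj₁ w∈) (proj₁ z∈) , ≤-respˡ-≈ (sym (normSq-* w z)) (normSq-≤-* w∈ z∈)

  -- The inner product is bounded by Lagrange's identity
  -- (ac + bd)² + (ad - bc)² = (a² + b²)(c² + d²).
  inDisc-+ : InDisc s w → InDisc t z → InDisc (s + t) (w +ᶜ z)
  inDisc-+ {s} {w@(a +i b)} {t} {z@(c +i d)} w∈@(0≤s , w≤s) z∈@(0≤t , z≤t) =
    +-nonneg 0≤s 0≤t , ≤-by
      (solve 6 (λ a b c d s t →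
          (s :+ t) :* (s :+ t) :- ((a :+ c) :* (a :+ c) :+ (b :+ d) :* (b :+ d))
        := ((s :* s :- (a :* a :+ b :* b)) :+ (t :* t :- (c :* c :+ d :* d)))
           :+ ((s :* t :- (a :* c :+ b :* d)) :+ (s :* t :- (a :* c :+ b :* d))))
        refl a b c d s t)
      (+-nonneg (+-nonneg (x≤y⇒0≤y-x w≤s) (x≤y⇒0≤y-x z≤t)) (+-nonneg cross cross))
    where
    cross : 0# ≤ s * t - (a * c + b * d)
    cross = x≤y⇒0≤y-x (square-cancel-≤ (*-nonneg 0≤s 0≤t)
      (≤-trans
        (≤-by (solve 4 (λ a b c d →
                  (a :* a :+ b :* b) :* (c :* c :+ d :* d)
                    :- (a :* c :+ b :* d) :* (a :* c :+ b :* d)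
                := (a :* d :- b :* c) :* (a :* d :- b :* c)) refl a b c d)
              (square-nonneg _))
        (normSq-≤-* w∈ z∈)))

  -- The hypotheses say -s ≤ x ≤ s; their product is s² - x².
  inDisc-ofReal : ∀ {x} → 0# ≤ s → 0# ≤ s - x → 0# ≤ s + x → InDisc s (ofReal x)
  inDisc-ofReal {s} {x} 0≤s x≤s -s≤x = 0≤s , ≤-by
    (solve 2 (λ s x → s :* s :- (x :* x :+ con (+ 0) :* con (+ 0))
         := (s :- x) :* (s :+ x)) refl s x)
    (*-nonneg x≤s -s≤x)

  inDisc-ofReal⁻¹ : ∀ {x} → InDisc s (ofReal x) → x ≤ s
  inDisc-ofReal⁻¹ {x = x} (0≤s , x≤s) = square-cancel-≤ 0≤s
    (≤-respˡ-≈ (solve 1 (λ x → x :* x :+ con (+ 0) :* con (+ 0) := x :* x) refl x) x≤s)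

  -- Horner's scheme: started at `ofReal 1#`, this is a monic integer polynomial in z whose other
  -- coefficients are the negated digits.
  orbit : ℂ → ℂ → List ℕ → ℂ
  orbit z y []       = y
  orbit z y (a ∷ as) = orbit z (z *ᶜ y +ᶜ -ᶜ ofReal (fromℕ a)) as

  orbit-cong : ∀ z as {y y′} → y ≈ᶜ y′ → orbit z y as ≈ᶜ orbit z y′ as
  orbit-cong z []       y≈y′ = y≈y′
  orbit-cong z (a ∷ as) y≈y′ = orbit-cong z as (ℂ-Ring.+-congʳ (ℂ-Ring.*-congˡ {z} y≈y′))

  PositiveLast : ℕ → List ℕ → Set
  PositiveLast a []       = 1 ℕ.≤ a
  PositiveLast _ (b ∷ bs) = PositiveLast b bs

-- The orbit cannot end at 0 when D is positive.

module RootBound {ℓ} (ℝ : RealNumbers ℓ) where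
  open Reals ℝ
  open OrderedField ℝ
  open Complex ℝ
  private module S = ℂ-Solver

  module _ (m : ℕ) (1≤m : 1 ℕ.≤ m) (r : Carrier) (z : ℂ) (z∈ : InDisc r z)
           (0<D : 0# < 1# - (fromℕ m * r + r * r)) where

    private
      M δ D : Carrier
      M = fromℕ m
      δ = 1# - r
      D = 1# - (M * r + r * r)

      0≤r : 0# ≤ r
      0≤r = proj₁ z∈

      0≤M-1 : 0# ≤ M - 1#
      0≤M-1 = x≤y⇒0≤y-x (1≤fromℕ 1≤m)

      -- Since m ≥ 1, 1 - r exceeds D by the nonnegative amount r² + (m - 1) r. Division by 1 - r is
      -- avoided throughout by scaling the points of the orbit by δ.
      0<δ : 0# < δ
      0<δ = <-respʳ-≈
        (solve 2 (λ r M → (con (+ 1) :- (M :* r :+ r :* r)) :+ (r :* r :+ (M :- con (+ 1)) :* r)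
                        := con (+ 1) :- r) refl r M)
        (+-pos-nonneg 0<D (+-nonneg (*-nonneg 0≤r 0≤r) (*-nonneg 0≤M-1 0≤r)))

      0≤δ : 0# ≤ δ
      0≤δ = <⇒≤ 0<δ

      δ∈ : InDisc δ (ofReal δ)
      δ∈ = inDisc-ofReal 0≤δ (≤-reflexive (sym (-‿inverseʳ δ))) (+-nonneg 0≤δ 0≤δ)

      digit≤ : ∀ {a} → a ℕ.≤ m → 0# ≤ M - fromℕ a
      digit≤ a≤m = x≤y⇒0≤y-x (fromℕ-mono-≤ a≤m)

      digit∈ : ∀ {a} → a ℕ.≤ m → InDisc M (-ᶜ ofReal (fromℕ a))
      digit∈ {a} a≤m = inDisc-resp-≈ (ofReal-homo-neg (fromℕ a)) (inDisc-ofReal (0≤fromℕ m)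
        (≤-respʳ-≈ (solve 2 (λ M a → M :+ a
                        := M :- :- a) refl M (fromℕ a)) (+-nonneg (0≤fromℕ m) (0≤fromℕ a)))
        (digit≤ a≤m))

      ofReal-homo-- : ∀ x y → ofReal (x - y) ≈ᶜ ofReal x +ᶜ -ᶜ ofReal y
      ofReal-homo-- x y = ℂ-Ring.trans (ofReal-homo-+ x (- y)) (ℂ-Ring.+-congˡ (ofReal-homo-neg y))

      digitDiff∈ : ∀ {N a b} → 0# ≤ N → 0# ≤ N - (fromℕ a - fromℕ b) → 0# ≤ N + (fromℕ a - fromℕ b) →
                   InDisc N (ofReal (fromℕ a) +ᶜ -ᶜ ofReal (fromℕ b))
      digitDiff∈ 0≤N p q = inDisc-resp-≈ (ofReal-homo-- _ _) (inDisc-ofReal 0≤N p q)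

      -- With p, p′ = zp - b and p″ = zp′ - a consecutive points of the orbit,
      -- the differences satisfy p″ - p′ = z(p′ - p) + (b - a).
      no-zero-from : ∀ p b a as → b ℕ.≤ m → All (ℕ._≤ m) (a ∷ as) → PositiveLast a as →
                     InDisc M (ofReal δ *ᶜ p) →
                     InDisc (M + D) (ofReal δ *ᶜ (z *ᶜ p +ᶜ -ᶜ ofReal (fromℕ b) +ᶜ -ᶜ p)) →
                     ¬ (orbit z (z *ᶜ p +ᶜ -ᶜ ofReal (fromℕ b)) (a ∷ as) ≈ᶜ ofReal 0#)
      no-zero-from p zero a [] _ (a≤m ∷ []) 1≤a p∈ _ eq = δa≤ (<-≤-trans rrM<δ δ≤δa)
        where
        A : Carrier
        A = fromℕ a

        -- With b = 0 the last two steps of the orbit collapse to a = z² p.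
        δa-eq : ofReal δ *ᶜ ofReal A ≈ᶜ z *ᶜ z *ᶜ (ofReal δ *ᶜ p)
        δa-eq = ℂ-Ring.trans
          (S.solve 4 (λ δ z p a → δ S.:* a
              S.:= z S.:* z S.:* (δ S.:* p) S.:- δ S.:* (z S.:* (z S.:* p S.:- S.con (+ 0)) S.:- a))
            ℂ-Ring.refl (ofReal δ) z p (ofReal A))
          (ℂ-Ring.trans (ℂ-Ring.+-congˡ (ℂ-Ring.-‿cong (ℂ-Ring.*-congˡ {ofReal δ} eq)))
            (S.solve 2 (λ δ w → w S.:- δ S.:* S.con (+ 0) S.:= w) ℂ-Ring.refl (ofReal δ) _))

        δa≤ : δ * A ≤ r * r * M
        δa≤ = inDisc-ofReal⁻¹ (inDisc-resp-≈
          (ℂ-Ring.trans (ℂ-Ring.sym δa-eq) (ℂ-Ring.sym (ofReal-homo-* δ A)))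
          (inDisc-* (inDisc-* z∈ z∈) p∈))

        δ≤δa : δ ≤ δ * A
        δ≤δa = ≤-by (solve 2 (λ δ a → δ :* a :- δ := δ :* (a :- con (+ 1))) refl δ A)
                    (*-nonneg 0≤δ (x≤y⇒0≤y-x (1≤fromℕ 1≤a)))

        -- The gap is D + (m - 1) r (1 - r).
        rrM<δ : r * r * M < δ
        rrM<δ = <-by
          (solve 2 (λ r M → (con (+ 1) :- r) :- r :* r :* M
             := (con (+ 1) :- (M :* r :+ r :* r)) :+ (M :- con (+ 1)) :* r :* (con (+ 1) :- r))
             refl r M)
          (+-pos-nonneg 0<D (*-nonneg (*-nonneg 0≤M-1 0≤r) 0≤δ))
      no-zero-from p b@(suc _) a [] b≤m (a≤m ∷ []) 1≤a _ e∈ eq = δa≤ (<-≤-trans bound<δ δ≤δa)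
        where
        A B : Carrier
        A = fromℕ a
        B = fromℕ b

        e : ℂ
        e = z *ᶜ p +ᶜ -ᶜ ofReal B +ᶜ -ᶜ p

        -- The relations z p′ = a, p′ = z p - b and e = p′ - p give a = z (a - b) - z² e. The solver
        -- obtains it by subtracting δ (1 - z) times the vanishing end point.
        δa-eq : ofReal δ *ᶜ ofReal A ≈ᶜ
                z *ᶜ (ofReal δ *ᶜ (ofReal A +ᶜ -ᶜ ofReal B)) +ᶜ -ᶜ z *ᶜ z *ᶜ (ofReal δ *ᶜ e)
        δa-eq = ℂ-Ring.trans
          (S.solve 5 (λ δ z p a b → δ S.:* a
              S.:= (z S.:* (δ S.:* (a S.:- b)) S.:+ S.:- z S.:* z S.:* (δ S.:* (z S.:* p S.:- b S.:- p)))
                   S.:- δ S.:* (S.con (+ 1) S.:- z) S.:* (z S.:* (z S.:* p S.:- b) S.:- a))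
            ℂ-Ring.refl (ofReal δ) z p (ofReal A) (ofReal B))
          (ℂ-Ring.trans (ℂ-Ring.+-congˡ (ℂ-Ring.-‿cong (ℂ-Ring.*-congˡ {ofReal δ *ᶜ (ofReal 1# +ᶜ -ᶜ z)} eq)))
            (S.solve 2 (λ δ w → w S.:- δ S.:* S.con (+ 0) S.:= w) ℂ-Ring.refl _ _))

        -z∈ : InDisc r (-ᶜ z)
        -z∈ = 0≤r , ≤-respˡ-≈
          (solve 2 (λ x y → x :* x :+ y :* y
               := (:- x) :* (:- x) :+ (:- y) :* (:- y)) refl (re z) (im z))
          (proj₂ z∈)

        1≤A : 0# ≤ A - 1#
        1≤A = x≤y⇒0≤y-x (1≤fromℕ 1≤a)

        1≤B : 0# ≤ B - 1#
        1≤B = x≤y⇒0≤y-x (1≤fromℕ {b} (s≤s z≤n))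

        -- Here the case split on b pays off: two digits in [1, m] differ by at most m - 1.
        A-B∈ : InDisc (M - 1#) (ofReal A +ᶜ -ᶜ ofReal B)
        A-B∈ = digitDiff∈ {a = a} {b = b} 0≤M-1
          (≤-respʳ-≈ (solve 3 (λ M a b → (M :- a) :+ (b :- con (+ 1))
                          := (M :- con (+ 1)) :- (a :- b)) refl M A B)
            (+-nonneg (digit≤ a≤m) 1≤B))
          (≤-respʳ-≈ (solve 3 (λ M a b → (M :- b) :+ (a :- con (+ 1))
                          := (M :- con (+ 1)) :+ (a :- b)) refl M A B)
            (+-nonneg (digit≤ b≤m) 1≤A))

        δa≤ : δ * A ≤ r * (δ * (M - 1#)) + r * r * (M + D)
        δa≤ = inDisc-ofReal⁻¹ (inDisc-resp-≈
          (ℂ-Ring.trans (ℂ-Ring.sym δa-eq) (ℂ-Ring.sym (ofReal-homo-* δ A)))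
          (inDisc-+ (inDisc-* z∈ (inDisc-* δ∈ A-B∈)) (inDisc-* (inDisc-* -z∈ z∈) e∈)))

        δ≤δa : δ ≤ δ * A
        δ≤δa = ≤-by (solve 2 (λ δ a → δ :* a :- δ := δ :* (a :- con (+ 1))) refl δ A)
                    (*-nonneg 0≤δ 1≤A)

        -- The gap factors as D (1 - r) (1 + r), so the positivity of D is exactly what is required.
        bound<δ : r * (δ * (M - 1#)) + r * r * (M + D) < δ
        bound<δ = <-by
          (solve 2 (λ r M → let δ = con (+ 1) :- r ; D = con (+ 1) :- (M :* r :+ r :* r) in
             δ :- (r :* (δ :* (M :- con (+ 1))) :+ r :* r :* (M :+ D))
               := D :* (δ :+ r :* δ)) refl r M)
          (*-pos 0<D (+-pos-nonneg 0<δ (*-nonneg 0≤r 0≤δ)))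
      -- Both bounds survive a step of the orbit: r m + (1 - r) m = m, and r (m + D) + (1 - r) m
      -- falls short of m + D by (1 - r) D.
      no-zero-from p b a (a′ ∷ as) b≤m (a≤m ∷ as≤m) pos p∈ e∈ =
        no-zero-from (z *ᶜ p +ᶜ -ᶜ ofReal (fromℕ b)) a a′ as a≤m as≤m pos
          (inDisc-mono (≤-reflexive (solve 2 (λ r M → r :* M :+ (con (+ 1) :- r) :* M
                                         := M) refl r M))
            (inDisc-resp-≈
              (S.solve 4 (λ δ z p b → z S.:* (δ S.:* p) S.:+ δ S.:* S.:- b
                     S.:= δ S.:* (z S.:* p S.:- b))
                ℂ-Ring.refl (ofReal δ) z p (ofReal (fromℕ b)))
              (inDisc-+ (inDisc-* z∈ p∈) (inDisc-* δ∈ (digit∈ b≤m)))))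
          (inDisc-mono
            (≤-by (solve 3 (λ r M D → (M :+ D) :- (r :* (M :+ D) :+ (con (+ 1) :- r) :* M)
                       := (con (+ 1) :- r) :* D) refl r M D)
              (*-nonneg 0≤δ (<⇒≤ 0<D)))
            (inDisc-resp-≈
              (S.solve 5 (λ δ z p a b →
                  z S.:* (δ S.:* (z S.:* p S.:- b S.:- p)) S.:+ δ S.:* (b S.:- a)
                    S.:= δ S.:* (z S.:* (z S.:* p S.:- b) S.:- a S.:- (z S.:* p S.:- b)))
                ℂ-Ring.refl (ofReal δ) z p (ofReal (fromℕ a)) (ofReal (fromℕ b)))
              (inDisc-+ (inDisc-* z∈ e∈) (inDisc-* δ∈ b-a∈))))
        where
        b-a∈ : InDisc M (ofReal (fromℕ b) +ᶜ -ᶜ ofReal (fromℕ a))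
        b-a∈ = digitDiff∈ {a = b} {b = a} (0≤fromℕ m)
          (≤-respʳ-≈ (solve 3 (λ M a b → (M :- b) :+ a := M :- (b :- a)) refl M (fromℕ a) (fromℕ b))
            (+-nonneg (digit≤ b≤m) (0≤fromℕ a)))
          (≤-respʳ-≈ (solve 3 (λ M a b → (M :- a) :+ b := M :+ (b :- a)) refl M (fromℕ a) (fromℕ b))
            (+-nonneg (digit≤ a≤m) (0≤fromℕ b)))

    orbit-no-zero : ∀ a as → All (ℕ._≤ m) (a ∷ as) → PositiveLast a as →
                    ¬ (orbit z (ofReal 1#) (a ∷ as) ≈ᶜ ofReal 0#)
    -- With a single digit the end point is z - a, so z = a ≥ 1 although |z| ≤ r < 1.
    orbit-no-zero a [] _ 1≤a eq = a≤r (<-≤-trans (0<y-x⇒x<y 0<δ) (1≤fromℕ 1≤a))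
      where
      a≤r : fromℕ a ≤ r
      a≤r = inDisc-ofReal⁻¹ (inDisc-resp-≈
        (ℂ-Ring.trans
          (S.solve 2 (λ z a → z
                 S.:= a S.:+ (z S.:* S.con (+ 1) S.:- a)) ℂ-Ring.refl z (ofReal (fromℕ a)))
          (ℂ-Ring.trans (ℂ-Ring.+-congˡ eq) (ℂ-Ring.+-identityʳ _)))
        z∈)
    orbit-no-zero a (a′ ∷ as) (a≤m ∷ as≤m) pos =
      no-zero-from (ofReal 1#) a a′ as a≤m as≤m pos
        (inDisc-mono (≤-by (solve 2 (λ r M → M :- (con (+ 1) :- r)
                                := (M :- con (+ 1)) :+ r) refl r M) (+-nonneg 0≤M-1 0≤r))
          (inDisc-resp-≈ (ℂ-Ring.sym (ℂ-Ring.*-identityʳ _)) δ∈))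
        -- The first difference is z - a - 1, and (1 - r) (r + m + 1) = m + D.
        (inDisc-mono
          (≤-reflexive (solve 2 (λ r M → (con (+ 1) :- r) :* (r :+ M :+ con (+ 1))
                                    := M :+ (con (+ 1) :- (M :* r :+ r :* r))) refl r M))
          (inDisc-* δ∈ (inDisc-+ (inDisc-+ z*1∈ (digit∈ a≤m)) -1∈)))
      where
      z*1∈ : InDisc r (z *ᶜ ofReal 1#)
      z*1∈ = inDisc-resp-≈ (ℂ-Ring.sym (ℂ-Ring.*-identityʳ z)) z∈

      -1∈ : InDisc 1# (-ᶜ ofReal 1#)
      -1∈ = inDisc-resp-≈ (ofReal-homo-neg 1#) (inDisc-ofReal 0≤1
        (≤-respʳ-≈ (solve 0 (con (+ 1) :+ con (+ 1)
                        := con (+ 1) :- :- con (+ 1)) refl) (+-nonneg 0≤1 0≤1))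
        (≤-reflexive (sym (-‿inverseʳ 1#))))

-- The embedding of ℚ is a ring homomorphism.

module Rationals {ℓ} (ℝ : RealNumbers ℓ) where
  open Reals ℝ
  open OrderedField ℝ
  open CommutativeRing commutativeRing using (semiring)
  open TCMult semiring using (×ᵤ≈×)

  fromℤ≈ofℤ : ∀ i → fromℤ i ≈ ofℤ i
  fromℤ≈ofℤ (+ n)    = ×ᵤ≈× n 1#
  fromℤ≈ofℤ -[1+ n ] = -‿cong (×ᵤ≈× (suc n) 1#)

  fromℕ-pos-cancel : ∀ n {x y} → x * fromℕ (suc n) ≈ y * fromℕ (suc n) → x ≈ y
  fromℕ-pos-cancel n {x} {y} eq = begin
    x                                    ≈⟨ undo x ⟨
    x * fromℕ (suc n) * 1/ (suc n)       ≈⟨ *-congʳ eq ⟩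
    y * fromℕ (suc n) * 1/ (suc n)       ≈⟨ undo y ⟩
    y                                    ∎
    where
    open ≈-Reasoning setoid
    undo : ∀ x → x * fromℕ (suc n) * 1/ (suc n) ≈ x
    undo x = begin
      x * fromℕ (suc n) * 1/ (suc n)     ≈⟨ *-assoc _ _ _ ⟩
      x * (fromℕ (suc n) * 1/ (suc n))   ≈⟨ *-congˡ (*-comm _ _) ⟩
      x * (1/ (suc n) * fromℕ (suc n))   ≈⟨ *-congˡ (1/-inverseˡ n) ⟩
      x * 1#                             ≈⟨ *-identityʳ x ⟩
      x                                  ∎

  infix 4 _Represents_
  -- Cross-multiplied form of x = p. Sums and products of rationals are thereby computed on
  -- unnormalised fractions, without following the reduction to lowest terms.
  _Represents_ : Carrier → ℚᵘ → Set ℓ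
  x Represents p = x * ofℤ (↧ᵘ p) ≈ ofℤ (↥ᵘ p)

  represents-unique : ∀ {x y p q} → p ℚᵘ.≃ q → x Represents p → y Represents q → x ≈ y
  represents-unique {x} {y} {p@(mkℚᵘ a b)} {q@(mkℚᵘ c d)} (*≡* ad≡cb) x=p y=q =
    fromℕ-pos-cancel b (fromℕ-pos-cancel d (begin
      x * fromℕ (suc b) * fromℕ (suc d)  ≈⟨ *-cong (*-congˡ (×ᵤ≈× (suc b) 1#)) (×ᵤ≈× (suc d) 1#) ⟩
      x * ofℤ (↧ᵘ p) * ofℤ (↧ᵘ q)        ≈⟨ *-congʳ x=p ⟩
      ofℤ a * ofℤ (↧ᵘ q)                 ≈⟨ ofℤ-homo-* a (↧ᵘ q) ⟨
      ofℤ (a ℤ.* ↧ᵘ q)                   ≡⟨ ≡.cong ofℤ ad≡cb ⟩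
      ofℤ (c ℤ.* ↧ᵘ p)                   ≈⟨ ofℤ-homo-* c (↧ᵘ p) ⟩
      ofℤ c * ofℤ (↧ᵘ p)                 ≈⟨ *-congʳ y=q ⟨
      y * ofℤ (↧ᵘ q) * ofℤ (↧ᵘ p)        ≈⟨ *-assoc _ _ _ ⟩
      y * (ofℤ (↧ᵘ q) * ofℤ (↧ᵘ p))      ≈⟨ *-congˡ (*-comm _ _) ⟩
      y * (ofℤ (↧ᵘ p) * ofℤ (↧ᵘ q))      ≈⟨ *-assoc _ _ _ ⟨
      y * ofℤ (↧ᵘ p) * ofℤ (↧ᵘ q)        ≈⟨ *-cong (*-congˡ (×ᵤ≈× (suc b) 1#)) (×ᵤ≈× (suc d) 1#) ⟨
      y * fromℕ (suc b) * fromℕ (suc d)  ∎))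
    where open ≈-Reasoning setoid

  represents-fromℚ : ∀ p → fromℚ p Represents toℚᵘ p
  represents-fromℚ p@(ℚ.mkℚ n d _) = begin
    fromℤ n * 1/ (suc d) * ofℤ (+ suc d)     ≈⟨ *-congˡ (×ᵤ≈× (suc d) 1#) ⟨
    fromℤ n * 1/ (suc d) * fromℕ (suc d)     ≈⟨ *-assoc _ _ _ ⟩
    fromℤ n * (1/ (suc d) * fromℕ (suc d))   ≈⟨ *-congˡ (1/-inverseˡ d) ⟩
    fromℤ n * 1#                             ≈⟨ *-identityʳ _ ⟩
    fromℤ n                                  ≈⟨ fromℤ≈ofℤ n ⟩
    ofℤ n                                    ∎
    where open ≈-Reasoning setoid

  represents-+ : ∀ {x y} p q → x Represents p → y Represents q → (x + y) Represents (p ℚᵘ.+ q)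
  represents-+ {x} {y} p@record{} q@record{} x=p y=q = begin
    (x + y) * ofℤ (↧ᵘ p ℤ.* ↧ᵘ q)                    ≈⟨ *-congˡ (ofℤ-homo-* (↧ᵘ p) (↧ᵘ q)) ⟩
    (x + y) * (P * Q)
      ≈⟨ solve 4 (λ x y p q → (x :+ y) :* (p :* q) := x :* p :* q :+ y :* q :* p) refl x y P Q ⟩
    x * P * Q + y * Q * P                            ≈⟨ +-cong (*-congʳ x=p) (*-congʳ y=q) ⟩
    ofℤ (↥ᵘ p) * Q + ofℤ (↥ᵘ q) * P
      ≈⟨ +-cong (ofℤ-homo-* (↥ᵘ p) (↧ᵘ q)) (ofℤ-homo-* (↥ᵘ q) (↧ᵘ p)) ⟨
    ofℤ (↥ᵘ p ℤ.* ↧ᵘ q) + ofℤ (↥ᵘ q ℤ.* ↧ᵘ p)        ≈⟨ ofℤ-homo-+ (↥ᵘ p ℤ.* ↧ᵘ q) (↥ᵘ q ℤ.* ↧ᵘ p) ⟨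
    ofℤ (↥ᵘ p ℤ.* ↧ᵘ q ℤ.+ ↥ᵘ q ℤ.* ↧ᵘ p)            ∎
    where
    open ≈-Reasoning setoid
    P = ofℤ (↧ᵘ p)
    Q = ofℤ (↧ᵘ q)

  represents-* : ∀ {x y} p q → x Represents p → y Represents q → (x * y) Represents (p ℚᵘ.* q)
  represents-* {x} {y} p@record{} q@record{} x=p y=q = begin
    (x * y) * ofℤ (↧ᵘ p ℤ.* ↧ᵘ q)                    ≈⟨ *-congˡ (ofℤ-homo-* (↧ᵘ p) (↧ᵘ q)) ⟩
    (x * y) * (P * Q)
      ≈⟨ solve 4 (λ x y p q → (x :* y) :* (p :* q) := (x :* p) :* (y :* q)) refl x y P Q ⟩
    (x * P) * (y * Q)                                ≈⟨ *-cong x=p y=q ⟩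
    ofℤ (↥ᵘ p) * ofℤ (↥ᵘ q)                          ≈⟨ ofℤ-homo-* (↥ᵘ p) (↥ᵘ q) ⟨
    ofℤ (↥ᵘ p ℤ.* ↥ᵘ q)                              ∎
    where
    open ≈-Reasoning setoid
    P = ofℤ (↧ᵘ p)
    Q = ofℤ (↧ᵘ q)

  fromℚ-homo-+ : ∀ p q → fromℚ (p ℚ.+ q) ≈ fromℚ p + fromℚ q
  fromℚ-homo-+ p q = represents-unique (ℚ.toℚᵘ-homo-+ p q)
    (represents-fromℚ (p ℚ.+ q)) (represents-+ (toℚᵘ p) (toℚᵘ q) (represents-fromℚ p) (represents-fromℚ q))

  fromℚ-homo-* : ∀ p q → fromℚ (p ℚ.* q) ≈ fromℚ p * fromℚ q
  fromℚ-homo-* p q = represents-unique (ℚ.toℚᵘ-homo-* p q)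
    (represents-fromℚ (p ℚ.* q)) (represents-* (toℚᵘ p) (toℚᵘ q) (represents-fromℚ p) (represents-fromℚ q))

  fromℚ-toℚ : ∀ i → fromℚ (toℚ i) ≈ fromℤ i
  fromℚ-toℚ i = trans (trans (sym (*-identityʳ _)) (represents-fromℚ (toℚ i))) (sym (fromℤ≈ofℤ i))

-- Rational polynomials vanishing at q vanish at its conjugates.

module Conjugates {ℓ} (ℝ : RealNumbers ℓ) where
  open Reals ℝ
  open OrderedField ℝ
  open Complex ℝ
  open Rationals ℝ
  private module C = ℂ-Ring
  private module S = ℂ-Solver

  embed : ℚ → ℂ
  embed a = ofReal (fromℚ a)

  embed-homo-+ : ∀ a b → embed (a ℚ.+ b) ≈ᶜ embed a +ᶜ embed b
  embed-homo-+ a b = C.trans (fromℚ-homo-+ a b , refl) (ofReal-homo-+ _ _)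

  embed-homo-* : ∀ a b → embed (a ℚ.* b) ≈ᶜ embed a *ᶜ embed b
  embed-homo-* a b = C.trans (fromℚ-homo-* a b , refl) (ofReal-homo-* _ _)

  embed-0 : embed 0ℚ ≈ᶜ ofReal 0#
  embed-0 = zeroˡ _ , refl

  embed-1 : embed ℚ.1ℚ ≈ᶜ ofReal 1#
  embed-1 = trans (fromℚ-toℚ (+ 1)) (+-identityʳ 1#) , refl

  monicAt : ∀ {n} → Vec ℚ n → ℂ → ℂ
  monicAt p = evalMonic (Vec.map embed p)

  polyAt : ∀ {n} → Vec ℚ n → ℂ → ℂ
  polyAt []      z = ofReal 0#
  polyAt (a ∷ p) z = embed a +ᶜ z *ᶜ polyAt p z

  -- Minimality speaks of monic polynomials only, so a remainder has to be made monic before it can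
  -- be used. This is possible since equality with 0 is decidable for its rational coefficients.
  data Normalised {n} (p : Vec ℚ n) : Set ℓ where
    vanishing : (∀ z → polyAt p z ≈ᶜ ofReal 0#) → Normalised p
    scaled    : ∀ {k} c c⁻¹ (r : Vec ℚ k) → k ℕ.< n → c⁻¹ ℚ.* c ≡ ℚ.1ℚ →
                (∀ z → polyAt p z ≈ᶜ embed c *ᶜ monicAt r z) → Normalised p

  normalise : ∀ {n} (p : Vec ℚ n) → Normalised p
  normalise [] = vanishing λ _ → C.refl
  normalise (a ∷ p) with normalise p
  ... | scaled c c⁻¹ r k<n c⁻¹c≡1 p≈cr =
    scaled c c⁻¹ (c⁻¹ ℚ.* a ∷ r) (s≤s k<n) c⁻¹c≡1 λ z → begin
      embed a +ᶜ z *ᶜ polyAt p z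
        ≈⟨ C.+-cong a≈ (C.*-congˡ (p≈cr z)) ⟩
      embed c *ᶜ embed (c⁻¹ ℚ.* a) +ᶜ z *ᶜ (embed c *ᶜ monicAt r z)
        ≈⟨ S.solve 4 (λ c d z w → c S.:* d S.:+ z S.:* (c S.:* w) S.:= c S.:* (d S.:+ z S.:* w))
             C.refl (embed c) (embed (c⁻¹ ℚ.* a)) z (monicAt r z) ⟩
      embed c *ᶜ (embed (c⁻¹ ℚ.* a) +ᶜ z *ᶜ monicAt r z)       ∎
    where
    open ≈-Reasoning C.setoid
    a≈ : embed a ≈ᶜ embed c *ᶜ embed (c⁻¹ ℚ.* a)
    a≈ = begin
      embed a                           ≡⟨ ≡.cong embed (ℚ.*-identityˡ a) ⟨
      embed (ℚ.1ℚ ℚ.* a)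
        ≡⟨ ≡.cong (λ b → embed (b ℚ.* a)) (≡.trans (ℚ.*-comm c c⁻¹) c⁻¹c≡1) ⟨
      embed (c ℚ.* c⁻¹ ℚ.* a)           ≡⟨ ≡.cong embed (ℚ.*-assoc c c⁻¹ a) ⟩
      embed (c ℚ.* (c⁻¹ ℚ.* a))         ≈⟨ embed-homo-* c (c⁻¹ ℚ.* a) ⟩
      embed c *ᶜ embed (c⁻¹ ℚ.* a)      ∎
  ... | vanishing p≈0 with a ℚ.≟ 0ℚ
  ...   | yes ≡.refl = vanishing λ z → begin
      embed 0ℚ +ᶜ z *ᶜ polyAt p z       ≈⟨ C.+-cong embed-0 (C.*-congˡ (p≈0 z)) ⟩
      ofReal 0# +ᶜ z *ᶜ ofReal 0#
        ≈⟨ S.solve 1 (λ z → S.con (+ 0) S.:+ z S.:* S.con (+ 0) S.:= S.con (+ 0)) C.refl z ⟩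
      ofReal 0#                         ∎
    where open ≈-Reasoning C.setoid
  ...   | no a≢0 =
    scaled a (ℚ.1/ a) [] (s≤s z≤n) (ℚ.*-inverseˡ a) λ z → begin
      embed a +ᶜ z *ᶜ polyAt p z        ≈⟨ C.+-congˡ (C.*-congˡ (p≈0 z)) ⟩
      embed a +ᶜ z *ᶜ ofReal 0#
        ≈⟨ S.solve 2 (λ a z → a S.:+ z S.:* S.con (+ 0)
                 S.:= a S.:* S.con (+ 1)) C.refl (embed a) z ⟩
      embed a *ᶜ ofReal 1#              ∎
    where
    open ≈-Reasoning C.setoid
    instance _ = ℚ.≢-nonZero a≢0

  difference : ∀ {n} (v p : Vec ℚ n) →
               Σ[ s ∈ Vec ℚ n ] ∀ z → monicAt v z ≈ᶜ polyAt s z +ᶜ monicAt p z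
  difference []      []      = [] , λ z → C.sym (C.+-identityˡ _)
  difference (a ∷ v) (b ∷ p) with difference v p
  ... | s , v≈s+p = a ℚ.- b ∷ s , λ z → begin
    embed a +ᶜ z *ᶜ monicAt v z
      ≈⟨ C.+-cong a≈ (C.*-congˡ (v≈s+p z)) ⟩
    (embed (a ℚ.- b) +ᶜ embed b) +ᶜ z *ᶜ (polyAt s z +ᶜ monicAt p z)
      ≈⟨ S.solve 5 (λ d b z s p → (d S.:+ b) S.:+ z S.:* (s S.:+ p)
               S.:= (d S.:+ z S.:* s) S.:+ (b S.:+ z S.:* p))
           C.refl (embed (a ℚ.- b)) (embed b) z (polyAt s z) (monicAt p z) ⟩
    (embed (a ℚ.- b) +ᶜ z *ᶜ polyAt s z) +ᶜ (embed b +ᶜ z *ᶜ monicAt p z) ∎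
    where
    open ≈-Reasoning C.setoid
    a≈ : embed a ≈ᶜ embed (a ℚ.- b) +ᶜ embed b
    a≈ = begin
      embed a                          ≡⟨ ≡.cong embed (ℚ.+-identityʳ a) ⟨
      embed (a ℚ.+ 0ℚ)                 ≡⟨ ≡.cong (λ c → embed (a ℚ.+ c)) (ℚ.+-inverseˡ b) ⟨
      embed (a ℚ.+ (ℚ.- b ℚ.+ b))      ≡⟨ ≡.cong embed (ℚ.+-assoc a (ℚ.- b) b) ⟨
      embed (a ℚ.- b ℚ.+ b)            ≈⟨ embed-homo-+ (a ℚ.- b) b ⟩
      embed (a ℚ.- b) +ᶜ embed b       ∎

  -- A single step of Euclidean division: subtracting X^j p from v cancels the leading terms, and
  -- X^j p contributes nothing at the roots of p.
  remainder : ∀ {n} j (v : Vec ℚ (j ℕ.+ n)) (p : Vec ℚ n) →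
              Σ[ s ∈ Vec ℚ (j ℕ.+ n) ] ∀ z → IsRootℚ p z → monicAt v z ≈ᶜ polyAt s z
  remainder zero v p with difference v p
  ... | s , v≈s+p = s , λ z pz≈0 → C.trans (v≈s+p z) (C.trans (C.+-congˡ pz≈0) (C.+-identityʳ _))
  remainder (suc j) (a ∷ v) p with remainder j v p
  ... | s , v≈s = a ∷ s , λ z pz≈0 → C.+-congˡ (C.*-congˡ (v≈s z pz≈0))

  -- Strong induction on the degree k of v. Minimality gives n ≤ k, so one division step by p is
  -- possible. It keeps the values at both α and β, and what remains is either the zero polynomial
  -- or a multiple of a monic one of smaller degree that still vanishes at α.
  conjugate-root : ∀ {α β} → IsGaloisConjugate α β →
                   ∀ {k} (v : Vec ℚ k) → IsRootℚ v α → IsRootℚ v β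
  conjugate-root {α} {β} (n , p , (pα≈0 , minimal) , pβ≈0) {k} v = go (<-wellFounded k) v
    where
    open ≈-Reasoning C.setoid
    go : ∀ {k} → Acc ℕ._<_ k → (v : Vec ℚ k) → IsRootℚ v α → IsRootℚ v β
    go {k} (acc rec) v vα≈0 with k ℕ.∸ n | ℕ.m∸n+n≡m (minimal v vα≈0)
    ... | j | ≡.refl with remainder j v p
    ...   | s , v≈s with normalise s
    ...     | vanishing s≈0 = C.trans (v≈s β pβ≈0) (s≈0 β)
    ...     | scaled c c⁻¹ r l<k c⁻¹c≡1 s≈cr = begin
      monicAt v β                    ≈⟨ v≈s β pβ≈0 ⟩
      polyAt s β                     ≈⟨ s≈cr β ⟩
      embed c *ᶜ monicAt r β         ≈⟨ C.*-congˡ (go (rec l<k) r rα≈0) ⟩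
      embed c *ᶜ ofReal 0#           ≈⟨ C.zeroʳ (embed c) ⟩
      ofReal 0#                      ∎
      where
      -- The factor c is cancelled by multiplying with its rational inverse.
      rα≈0 : IsRootℚ r α
      rα≈0 = begin
        monicAt r α                                  ≈⟨ C.*-identityˡ _ ⟨
        ofReal 1# *ᶜ monicAt r α                     ≈⟨ C.*-congʳ embed-1 ⟨
        embed ℚ.1ℚ *ᶜ monicAt r α
          ≡⟨ ≡.cong (λ b → embed b *ᶜ monicAt r α) c⁻¹c≡1 ⟨
        embed (c⁻¹ ℚ.* c) *ᶜ monicAt r α             ≈⟨ C.*-congʳ (embed-homo-* c⁻¹ c) ⟩
        (embed c⁻¹ *ᶜ embed c) *ᶜ monicAt r α        ≈⟨ C.*-assoc (embed c⁻¹) (embed c) _ ⟩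
        embed c⁻¹ *ᶜ (embed c *ᶜ monicAt r α)        ≈⟨ C.*-congˡ (s≈cr α) ⟨
        embed c⁻¹ *ᶜ polyAt s α                      ≈⟨ C.*-congˡ (v≈s α pα≈0) ⟨
        embed c⁻¹ *ᶜ monicAt v α                     ≈⟨ C.*-congˡ vα≈0 ⟩
        embed c⁻¹ *ᶜ ofReal 0#                       ≈⟨ C.zeroʳ (embed c⁻¹) ⟩
        ofReal 0#                                    ∎

  -- Each step y ↦ z y - a prepends the constant coefficient -a to the vector of a monic polynomial.
  orbit-monic : ∀ as {k} (v : Vec ℚ k) →
                ∃[ l ] Σ[ w ∈ Vec ℚ l ] ∀ z → monicAt w z ≈ᶜ orbit z (monicAt v z) as
  orbit-monic []       {k} v = k , v , λ _ → C.refl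
  orbit-monic (a ∷ as)     v with orbit-monic as (toℚ (ℤ.- + a) ∷ v)
  ... | l , w , w≈orbit = l , w , λ z → C.trans (w≈orbit z)
    (orbit-cong z as (C.trans (C.+-comm _ _) (C.+-congˡ coefficient)))
    where
    fromℤ-neg : ∀ n → fromℤ (ℤ.- + n) ≈ - fromℕ n
    fromℤ-neg zero    = solve 0 (con (+ 0) := :- con (+ 0)) refl
    fromℤ-neg (suc n) = refl

    coefficient : embed (toℚ (ℤ.- + a)) ≈ᶜ -ᶜ ofReal (fromℕ a)
    coefficient = C.trans (trans (fromℚ-toℚ (ℤ.- + a)) (fromℤ-neg a) , refl) (ofReal-homo-neg _)

  conjugate-orbit : ∀ {α β} → IsGaloisConjugate α β → ∀ as →
                    orbit α (ofReal 1#) as ≈ᶜ ofReal 0# → orbit β (ofReal 1#) as ≈ᶜ ofReal 0#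
  conjugate-orbit {α} {β} conj as αs≈0 with orbit-monic as []
  ... | l , w , w≈orbit =
    C.trans (C.sym (w≈orbit β)) (conjugate-root conj w (C.trans (w≈orbit α) αs≈0))

-- Digits of a greedy expansion, cut after the last nonzero one.

module GreedyExpansions {ℓ} (ℝ : RealNumbers ℓ) where
  open Reals ℝ
  open OrderedField ℝ
  open Complex ℝ
  private module C = ℂ-Ring

  module _ (m : ℕ) (q : Carrier) (0<q : 0# < q) (q<m+1 : q < fromℕ (m ℕ.+ 1)) where

    digit-≤ : ∀ {x a} → x ≤ 1# → IsFloor a (q * x) → a ℕ.≤ m
    digit-≤ {x} {a} x≤1 (a≤qx , _) with a ℕ.≤? m
    ... | yes a≤m = a≤m
    ... | no  a≰m = contradiction (<-≤-trans q<m+1 (fromℕ-mono-≤ m+1≤a)) (≤-trans a≤qx qx≤q)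
      where
      m+1≤a : m ℕ.+ 1 ℕ.≤ a
      -- A digit above m would force m + 1 ≤ q x ≤ q, against q < m + 1.
      m+1≤a = ≡.subst (ℕ._≤ a) (ℕ.+-comm 1 m) (ℕ.≰⇒> a≰m)
      qx≤q : q * x ≤ q
      qx≤q = ≤-by (solve 2 (λ q x → q :- q :* x := q :* (con (+ 1) :- x)) refl q x)
                  (*-nonneg (<⇒≤ 0<q) (x≤y⇒0≤y-x x≤1))

    next-≤1 : ∀ x a → IsFloor a (q * x) → q * x - fromℕ a ≤ 1#
    next-≤1 x a (_ , qx<1+a) = ≤-by
      (solve 2 (λ y a → con (+ 1) :- (y :- a) := (con (+ 1) :+ a) :- y) refl (q * x) (fromℕ a))
      (<⇒≤ (x<y⇒0<y-x qx<1+a))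

    q-cancel : ∀ {x} → q * x ≈ 0# → x ≈ 0#
    q-cancel {x} qx≈0 = ≤-antisym
      (λ 0<x → <-irrefl (sym qx≈0) (*-pos 0<q 0<x))
      (λ x<0 → <-irrefl (trans qx≈0 (sym (zeroʳ q))) (*-monoʳ-< 0<q x<0))

    orbit-step : ∀ x a as → orbit (ofReal q) (ofReal (q * x - fromℕ a)) as ≈ᶜ ofReal 0# →
                 orbit (ofReal q) (ofReal x) (a ∷ as) ≈ᶜ ofReal 0#
    orbit-step x a as = C.trans (orbit-cong (ofReal q) as (C.sym
      (C.trans (ofReal-homo-+ (q * x) (- fromℕ a)) (C.+-cong (ofReal-homo-* q x) (ofReal-homo-neg (fromℕ a))))))

    TrimmedExpansion : Carrier → Set ℓ
    TrimmedExpansion x = ∃[ a ] ∃[ as ] All (ℕ._≤ m) (a ∷ as) × PositiveLast a as ×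
                         orbit (ofReal q) (ofReal x) (a ∷ as) ≈ᶜ ofReal 0#

    -- A GreedyExpansion may go on with digits 0 after the orbit has reached 0.
    trim : ∀ {x as} → x ≤ 1# → GreedyExpansion q x as → x ≈ 0# ⊎ TrimmedExpansion x
    trim x≤1 (done x≈0) = inj₁ x≈0
    trim {x} x≤1 (digit {a = a} floor rest) with trim (next-≤1 x a floor) rest
    ... | inj₂ (b , bs , bs≤m , pos , eq) =
      inj₂ (a , b ∷ bs , digit-≤ {x} {a} x≤1 floor ∷ bs≤m , pos , orbit-step x a (b ∷ bs) eq)
    -- A digit 0 before a vanishing point means q x = 0; hence x vanishes too and the digit is
    -- dropped.
    trim {x} x≤1 (digit {a = zero} floor rest) | inj₁ next≈0 =
      inj₁ (q-cancel (trans (sym (x-0≈x (q * x))) next≈0))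
    trim {x} x≤1 (digit {a = a@(suc _)} floor rest) | inj₁ next≈0 =
      inj₂ (a , [] , digit-≤ {x} {a} x≤1 floor ∷ [] , s≤s z≤n , orbit-step x a [] (next≈0 , refl))

-- Solving h u = a by suprema, and properties of the square root.

module Roots {ℓ} (ℝ : RealNumbers ℓ) where
  open Reals ℝ
  open OrderedField ℝ
  open Complex ℝ

  -- An inverse is invertible and hence apart from 0; were it negative, 1 would be negative.
  0<1/ : ∀ {x} → 0# < x → ∃[ y ] 0# < y × x * y ≈ 1#
  0<1/ {x} 0<x with #⇒invertible (#-sym (<⇒# 0<x))
  ... | y , _ , xy≈1 = y , 0<y , xy≈1′
    where
    xy≈1′ : x * y ≈ 1#
    xy≈1′ = trans (*-congʳ (sym (x-0≈x x))) xy≈1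
    0<y : 0# < y
    0<y with #⇒<⊎> (invertible⇒# {y} {0#}
                     (x , trans (*-congˡ (x-0≈x y)) xy≈1′ ,
                          trans (*-congʳ (x-0≈x y)) (trans (*-comm y x) xy≈1′)))
    ... | inj₂ 0<y = 0<y
    ... | inj₁ y<0 = contradiction (<-respˡ-≈ xy≈1′ (<-respʳ-≈ (zeroʳ x) (*-monoʳ-< 0<x y<0))) (<-asym 0<1)

  -- What makes the supremum of the points where h stays below a an exact solution of h u = a:
  -- strict monotonicity and Lipschitz bounds on [0, B]. The closure properties below build
  -- polynomials with nonnegative coefficients in Horner form.
  record Growth (h : Carrier → Carrier) : Set ℓ where
    field
      cong      : ∀ {x y} → x ≈ y → h x ≈ h y
      nonneg    : ∀ {x} → 0# ≤ x → 0# ≤ h x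
      mono-<    : ∀ {x y} → 0# ≤ x → x < y → h x < h y
      lipschitz : ∀ B → 0# ≤ B → ∃[ L ] 0# ≤ L ×
                  (∀ {x y} → 0# ≤ x → x ≤ y → y ≤ B → h y ≤ h x + L * (y - x))

    mono-≤ : ∀ {x y} → 0# ≤ x → x ≤ y → h x ≤ h y
    mono-≤ 0≤x x≤y hy<hx = <-tri λ where
      (inj₁ x<y)        → <-asym hy<hx (mono-< 0≤x x<y)
      (inj₂ (inj₁ x≈y)) → <-irrefl (sym (cong x≈y)) hy<hx
      (inj₂ (inj₂ y<x)) → x≤y y<x

  id-growth : Growth (λ x → x)
  id-growth = record
    { cong      = λ x≈y → x≈y
    ; nonneg    = λ 0≤x → 0≤x
    ; mono-<    = λ _ x<y → x<y
    ; lipschitz = λ _ _ → 1# , 0≤1 , λ {x} {y} _ _ _ →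
        ≤-reflexive (solve 2 (λ x y → y := x :+ con (+ 1) :* (y :- x)) refl x y)
    }

  const+-growth : ∀ {h} c → 0# ≤ c → Growth h → Growth (λ x → c + h x)
  const+-growth {h} c 0≤c g = record
    { cong      = λ x≈y → +-congˡ (G.cong x≈y)
    ; nonneg    = λ 0≤x → +-nonneg 0≤c (G.nonneg 0≤x)
    ; mono-<    = λ 0≤x x<y → +-monoʳ-< c (G.mono-< 0≤x x<y)
    ; lipschitz = λ B 0≤B → let L , 0≤L , lip = G.lipschitz B 0≤B in
        L , 0≤L , λ 0≤x x≤y y≤B →
          ≤-respʳ-≈ (sym (+-assoc c _ _)) (+-mono-≤ (≤-refl {c}) (lip 0≤x x≤y y≤B))
    }
    where module G = Growth g

  -- The product rule p′ r′ - p r = (p′ - p) r′ + p (r′ - r), with P and R bounding the factors.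
  *-increment-≤ : ∀ {Δ K L p p′ P r r′ R} → 0# ≤ Δ → 0# ≤ K → 0# ≤ L → 0# ≤ p → 0# ≤ r′ →
                  p′ ≤ p + K * Δ → p ≤ P → r′ ≤ r + L * Δ → r′ ≤ R →
                  p′ * r′ ≤ p * r + (K * R + P * L) * Δ
  *-increment-≤ {Δ} {K} {L} {p} {p′} {P} {r} {r′} {R} 0≤Δ 0≤K 0≤L 0≤p 0≤r′ p′≤ p≤P r′≤ r′≤R = ≤-by
    (solve 9 (λ K L p p′ P r r′ R Δ →
        (p :* r :+ (K :* R :+ P :* L) :* Δ) :- p′ :* r′
          := (((p :+ K :* Δ) :- p′) :* r′ :+ K :* Δ :* (R :- r′))
             :+ (p :* ((r :+ L :* Δ) :- r′) :+ (P :- p) :* (L :* Δ)))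
      refl K L p p′ P r r′ R Δ)
    (+-nonneg
      (+-nonneg (*-nonneg (x≤y⇒0≤y-x p′≤) 0≤r′) (*-nonneg (*-nonneg 0≤K 0≤Δ) (x≤y⇒0≤y-x r′≤R)))
      (+-nonneg (*-nonneg 0≤p (x≤y⇒0≤y-x r′≤)) (*-nonneg (x≤y⇒0≤y-x p≤P) (*-nonneg 0≤L 0≤Δ))))

  *-growth : ∀ {f g} → Growth f → Growth g → Growth (λ x → f x * g x)
  *-growth {f} {g} f-growth g-growth = record
    { cong      = λ x≈y → *-cong (F.cong x≈y) (G.cong x≈y)
    ; nonneg    = λ 0≤x → *-nonneg (F.nonneg 0≤x) (G.nonneg 0≤x)
    ; mono-<    = λ {x} {y} 0≤x x<y → ≤-<-trans
        (*-mono-≤ (G.nonneg 0≤x) (F.nonneg 0≤x) ≤-refl (<⇒≤ (G.mono-< 0≤x x<y)))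
        (*-monoˡ-< (≤-<-trans (G.nonneg 0≤x) (G.mono-< 0≤x x<y)) (F.mono-< 0≤x x<y))
    ; lipschitz = λ B 0≤B →
        let K , 0≤K , f-lip = F.lipschitz B 0≤B
            L , 0≤L , g-lip = G.lipschitz B 0≤B
        in K * g B + f B * L ,
           +-nonneg (*-nonneg 0≤K (G.nonneg 0≤B)) (*-nonneg (F.nonneg 0≤B) 0≤L) ,
           λ 0≤x x≤y y≤B → let 0≤y = ≤-trans 0≤x x≤y in
             *-increment-≤ (x≤y⇒0≤y-x x≤y) 0≤K 0≤L (F.nonneg 0≤x) (G.nonneg 0≤y)
               (f-lip 0≤x x≤y y≤B) (F.mono-≤ 0≤x (≤-trans x≤y y≤B))
               (g-lip 0≤x x≤y y≤B) (G.mono-≤ 0≤y y≤B)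
    }
    where
    module F = Growth f-growth
    module G = Growth g-growth

  square-growth : Growth (λ x → x * x)
  square-growth = *-growth id-growth id-growth

  -- For squaring this unfolds to `BelowSqrt`, so the results apply to `√` as it is defined.
  Below : (Carrier → Carrier) → Carrier → Pred Carrier ℓ
  Below h a x = x ≤ 0# ⊎ h x < a

  x<x+ε : ∀ x {ε} → 0# < ε → x < x + ε
  x<x+ε x {ε} = <-by (solve 2 (λ x ε → (x :+ ε) :- x := ε) refl x ε)

  x-ε<x : ∀ x {ε} → 0# < ε → x - ε < x
  x-ε<x x {ε} = <-by (solve 2 (λ x ε → x :- (x :- ε) := ε) refl x ε)

  -- With p and p′ the values of h at u and u + ε, a step of length ε changes h by at most L ε, too
  -- little to cross the gap to a.
  overshoot⁺ : ∀ {a p p′ L u ε} → p′ ≤ p + L * ((u + ε) - u) → L * ε < a - p → p′ < a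
  overshoot⁺ {a} {p} {_} {L} {u} {ε} p′≤ Lε<d = ≤-<-trans p′≤ (<-by
    (solve 5 (λ a p L u ε → a :- (p :+ L :* ((u :+ ε) :- u)) := (a :- p) :- L :* ε) refl a p L u ε)
    (x<y⇒0<y-x Lε<d))

  overshoot⁻ : ∀ {a p p′ L u ε} → p ≤ p′ + L * (u - (u - ε)) → L * ε < p - a → a < p′
  overshoot⁻ {a} {p} {p′} {L} {u} {ε} p≤ Lε<d = <-≤-trans
    (<-by (solve 4 (λ a p L ε → (p :- L :* ε) :- a
               := (p :- a) :- L :* ε) refl a p L ε) (x<y⇒0<y-x Lε<d))
    (≤-by (solve 5 (λ p p′ L u ε → p′ :- (p :- L :* ε)
               := (p′ :+ L :* (u :- (u :- ε))) :- p) refl p p′ L u ε)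
      (x≤y⇒0≤y-x p≤))

  increment-≤ : ∀ {a p p₀ L u} → p ≤ p₀ + L * (u - 0#) → p₀ ≤ a → p - a ≤ L * u
  increment-≤ {a} {p} {p₀} {L} {u} p≤ p₀≤a = ≤-by
    (solve 5 (λ p p₀ a L u → L :* u :- (p :- a)
         := ((p₀ :+ L :* (u :- con (+ 0))) :- p) :+ (a :- p₀)) refl p p₀ a L u)
    (+-nonneg (x≤y⇒0≤y-x p≤) (x≤y⇒0≤y-x p₀≤a))

  module _ {h : Carrier → Carrier} (h-growth : Growth h) where

    private module H = Growth h-growth

    -- A gap d between h u and a is bridged, in either direction, by a step
    -- ε = d / (L + d + 1), L being a Lipschitz constant of h.
    step : ∀ {L d} → 0# ≤ L → 0# < d →
           ∃[ ε ] 0# < ε × ε ≤ 1# × L * ε < d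
    step {L} {d} 0≤L 0<d = ε , 0<ε , ε≤1 , Lε<d
      where
      K = L + d + 1#
      0<1+[L+d] : 0# < 1# + (L + d)
      0<1+[L+d] = +-pos-nonneg 0<1 (+-nonneg 0≤L (<⇒≤ 0<d))
      inverse = 0<1/ (<-respʳ-≈ (+-comm 1# (L + d)) 0<1+[L+d])
      κ = proj₁ inverse
      Kκ≈1 : K * κ ≈ 1#
      Kκ≈1 = proj₂ (proj₂ inverse)
      ε = d * κ
      0<κ : 0# < κ
      0<κ = proj₁ (proj₂ inverse)
      0<ε : 0# < ε
      0<ε = *-pos 0<d 0<κ
      Kε≈d : K * ε ≈ d
      Kε≈d = trans (solve 3 (λ k d κ → k :* (d :* κ) := d :* (k :* κ)) refl K d κ)
                   (trans (*-congˡ Kκ≈1) (*-identityʳ d))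
      ε≤1 : ε ≤ 1#
      ε≤1 = ≤-respʳ-≈ Kκ≈1 (*-mono-≤ (<⇒≤ 0<κ) (+-nonneg (+-nonneg 0≤L (<⇒≤ 0<d)) 0≤1)
        (≤-by (solve 2 (λ L d → (L :+ d :+ con (+ 1)) :- d
                   := L :+ con (+ 1)) refl L d) (+-nonneg 0≤L 0≤1)) ≤-refl)
      Lε<d : L * ε < d
      Lε<d = <-respʳ-≈ Kε≈d (*-monoˡ-< 0<ε
        (<-by (solve 2 (λ L d → (L :+ d :+ con (+ 1)) :- L
                   := d :+ con (+ 1)) refl L d) (+-pos 0<d 0<1)))

    below-sup-nonneg : ∀ {a u} → IsSupremum (Below h a) u → 0# ≤ u
    below-sup-nonneg (upper , _) = upper (inj₁ ≤-refl)

    -- If h u < a, some u + ε still belongs to the set. If a < h u, then a < h (u - ε) for some ε,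
    -- and no member of the set exceeds u - ε. Either way u is not the supremum.
    below-sup : ∀ {a u} → h 0# ≤ a → IsSupremum (Below h a) u → h u ≈ a
    below-sup {a} {u} h0≤a sup@(upper , least) = ≤-antisym hu≤a a≤hu
      where
      0≤u : 0# ≤ u
      0≤u = below-sup-nonneg sup

      a≤hu : a ≤ h u
      -- The Lipschitz constant is taken on [0, u + 1], which contains u + ε because ε ≤ 1.
      a≤hu hu<a = let L , 0≤L , lip = H.lipschitz (u + 1#) (+-nonneg 0≤u 0≤1)
                      ε , 0<ε , ε≤1 , Lε<d = step 0≤L (x<y⇒0<y-x hu<a)
                      u<v = x<x+ε u 0<ε
                      hv≤ = lip 0≤u (<⇒≤ u<v) (+-mono-≤ (≤-refl {u}) ε≤1)
                  in upper (inj₂ (overshoot⁺ hv≤ Lε<d)) u<v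

      hu≤a : h u ≤ a
      hu≤a a<hu = let L , 0≤L , lip = H.lipschitz u 0≤u
                      ε , 0<ε , _ , Lε<d = step 0≤L (x<y⇒0<y-x a<hu)
                      s , s∈ , v<s = least (x-ε<x u 0<ε)
                  in impossible L 0≤L lip ε 0<ε Lε<d s s∈ v<s
        where
        impossible : ∀ L → 0# ≤ L → (∀ {x y} → 0# ≤ x → x ≤ y → y ≤ u → h y ≤ h x + L * (y - x)) →
                     ∀ ε → 0# < ε → L * ε < h u - a → ∀ s → Below h a s → u - ε < s → ⊥
        impossible L 0≤L lip ε 0<ε Lε<d s s∈ v<s = absurd s∈
          where
          v : Carrier
          v = u - ε

          -- If u < ε, then L u ≤ L ε < h u - a ≤ h u - h 0 ≤ L u, which is absurd.
          0≤v : 0# ≤ v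
          0≤v = x≤y⇒0≤y-x λ u<ε → *-mono-≤ 0≤u 0≤L ≤-refl (<⇒≤ u<ε)
            (<-≤-trans Lε<d (increment-≤ (lip ≤-refl 0≤u ≤-refl) h0≤a))

          a<hv : a < h v
          a<hv = overshoot⁻ (lip 0≤v (<⇒≤ (x-ε<x u 0<ε)) ≤-refl) Lε<d

          absurd : Below h a s → ⊥
          absurd (inj₁ s≤0)  = s≤0 (≤-<-trans 0≤v v<s)
          absurd (inj₂ hs<a) = <-asym a<hv (<-trans (H.mono-< 0≤v v<s) hs<a)

    below-≤ : ∀ {a y} → 0# < y → a < h y → UpperBound (Below h a) y
    below-≤ 0<y a<hy (inj₁ x≤0)  y<x = x≤0 (<-trans 0<y y<x)
    below-≤ 0<y a<hy (inj₂ hx<a) y<x =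
      <-asym (<-trans hx<a a<hy) (H.mono-< (<⇒≤ 0<y) y<x)

    below-located : ∀ a → Located (Below h a)
    below-located a {x} {y} x<y with <-dense x<y
    ... | t , x<t , t<y with <-cotrans x<t 0#
    ...   | inj₁ x<0 = inj₁ (0# , inj₁ ≤-refl , x<0)
    ...   | inj₂ 0<t with <-cotrans (H.mono-< (<⇒≤ 0<t) t<y) a
    ...     | inj₁ ht<a = inj₁ (t , inj₂ ht<a , x<t)
    ...     | inj₂ a<hy = inj₂ (below-≤ (<-trans 0<t t<y) a<hy)

    solution : ∀ {a y} → h 0# ≤ a → 0# < y → a < h y → ∃[ u ] 0# ≤ u × h u ≈ a
    solution {a} {y} h0≤a 0<y a<hy =
      proj₁ sup , below-sup-nonneg (proj₂ sup) , below-sup h0≤a (proj₂ sup)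
      where
      sup : ∃[ u ] IsSupremum (Below h a) u
      sup = supremum (Below h a) (0# , inj₁ ≤-refl) (y , below-≤ 0<y a<hy) (below-located a)

  private
    √-sup : ∀ a → IsSupremum (BelowSqrt a) (√ a)
    √-sup a = proj₂ (supremum (BelowSqrt a) (0# , inj₁ (<-irrefl refl))
                       (belowSqrt-bounded a) (belowSqrt-located a))

  √-nonneg : ∀ a → 0# ≤ √ a
  √-nonneg a = below-sup-nonneg square-growth (√-sup a)

  √-square : ∀ {a} → 0# ≤ a → √ a * √ a ≈ a
  √-square {a} 0≤a = below-sup square-growth (≤-respˡ-≈ (sym (zeroˡ 0#)) 0≤a) (√-sup a)

  ∣∣-inDisc : ∀ z → InDisc ∣ z ∣ z
  ∣∣-inDisc z = √-nonneg (normSq z) , ≤-reflexive (sym (√-square (normSq-nonneg z)))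

  inDisc-∣∣ : ∀ {s z} → InDisc s z → ∣ z ∣ ≤ s
  inDisc-∣∣ {s} {z} (0≤s , z≤s) = square-cancel-≤ 0≤s (≤-respˡ-≈ (sym (√-square (normSq-nonneg z))) z≤s)

-- Comparison of the constants cₘ with the bound for conjugates.

module Constants {ℓ} (ℝ : RealNumbers ℓ) where
  open Reals ℝ
  open OrderedField ℝ
  open Complex ℝ
  open Rationals ℝ
  open Roots ℝ
  open Mult (CommutativeRing.semiring commutativeRing) using (×-homo-+; ×1-homo-*)
  private module C = ℂ-Ring

  0≤1/2 : 0# ≤ 1/ 2
  0≤1/2 = <⇒≤ (<-respʳ-≈ (*-identityˡ (1/ 2)) (0<x⇒0<x/2 0<1))

  0≤ofℤ : ∀ n → 0# ≤ ofℤ (+ n)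
  0≤ofℤ n = ≤-respʳ-≈ (fromℤ≈ofℤ (+ n)) (0≤fromℕ n)

  fromℕ-square : ∀ m → fromℕ (m ℕ.^ 2) ≈ fromℕ m * fromℕ m
  fromℕ-square m = trans (×1-homo-* m (m ℕ.* 1)) (*-congˡ (trans (×1-homo-* m 1)
    (trans (*-congˡ (+-identityʳ 1#)) (*-identityʳ (fromℕ m)))))

  module _ (m : ℕ) where

    private
      M s : Carrier
      M = fromℕ m
      s = √ (fromℕ (m ℕ.^ 2 ℕ.+ 4))

    -- The positive root of X² + m X - 1, that is, the radius at which D vanishes.
    realBound : Carrier
    realBound = (s - M) / 2

    s² : s * s ≈ M * M + ofℤ (+ 4)
    s² = trans (√-square (0≤fromℕ (m ℕ.^ 2 ℕ.+ 4)))
      (trans (×-homo-+ 1# (m ℕ.^ 2) 4) (+-cong (fromℕ-square m) (fromℤ≈ofℤ (+ 4))))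

    M≤s : M ≤ s
    M≤s = square-cancel-≤ (√-nonneg _) (≤-respʳ-≈ (sym s²)
      (≤-by (solve 1 (λ M → (M :* M :+ con (+ 4)) :- M :* M := con (+ 4)) refl M) (0≤ofℤ 4)))

    realBound-nonneg : 0# ≤ realBound
    realBound-nonneg = *-nonneg (x≤y⇒0≤y-x M≤s) 0≤1/2

    -- Completing the square: 4 (b² + m b) = (2 b + m)² - m², where 2 b + m = s and s² = m² + 4.
    realBound-root : realBound * realBound + M * realBound ≈ 1#
    realBound-root = fromℕ-pos-cancel 3 (begin
      (b * b + M * b) * fromℕ 4                      ≈⟨ *-congˡ (fromℤ≈ofℤ (+ 4)) ⟩
      (b * b + M * b) * ofℤ (+ 4)
        ≈⟨ solve 2 (λ b M → (b :* b :+ M :* b) :* con (+ 4)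
               := (b :+ b :+ M) :* (b :+ b :+ M) :- M :* M) refl b M ⟩
      (b + b + M) * (b + b + M) - M * M              ≈⟨ +-congʳ (*-cong 2b+M≈s 2b+M≈s) ⟩
      s * s - M * M                                  ≈⟨ +-congʳ s² ⟩
      (M * M + ofℤ (+ 4)) - M * M
        ≈⟨ solve 1 (λ M → (M :* M :+ con (+ 4)) :- M :* M := con (+ 1) :* con (+ 4)) refl M ⟩
      1# * ofℤ (+ 4)                                 ≈⟨ *-congˡ (fromℤ≈ofℤ (+ 4)) ⟨
      1# * fromℕ 4                                   ∎)
      where
      open ≈-Reasoning setoid
      b : Carrier
      b = realBound
      2b+M≈s : b + b + M ≈ s
      2b+M≈s = trans (+-congʳ (x/2+x/2≈x (s - M))) (y-x+x≈y M s)

    -- With t the square root on the left, the claim is 2 M + 1 ≤ s + t.  Squaring twice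
    -- reduces it to (M² + M)² ≤ (M² + 4) (M² + 2 M - 3), that is 12 ≤ 8 M.
    c-large-≤ : 3 ℕ.≤ m →
                (fromℕ (m ℕ.+ 1) - √ (fromℕ (m ℕ.^ 2 ℕ.+ 2 ℕ.* m) - fromℕ 3)) / 2 ≤ realBound
    c-large-≤ 3≤m = *-mono-≤ 0≤1/2 (x≤y⇒0≤y-x M≤s) (≤-by rearrange (x≤y⇒0≤y-x 2M+1≤s+t)) ≤-refl
      where
      N a t : Carrier
      N = M - ofℤ (+ 3)
      a = fromℕ (m ℕ.^ 2 ℕ.+ 2 ℕ.* m) - fromℕ 3
      t = √ a

      0≤N : 0# ≤ N
      0≤N = x≤y⇒0≤y-x (≤-respˡ-≈ (fromℤ≈ofℤ (+ 3)) (fromℕ-mono-≤ 3≤m))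

      a≈ : a ≈ M * M + ofℤ (+ 2) * M - ofℤ (+ 3)
      a≈ = +-cong (trans (×-homo-+ 1# (m ℕ.^ 2) (2 ℕ.* m))
                    (+-cong (fromℕ-square m) (trans (×1-homo-* 2 m) (*-congʳ (fromℤ≈ofℤ (+ 2))))))
                  (-‿cong (fromℤ≈ofℤ (+ 3)))

      -- `√-square` needs a nonnegative radicand; in terms of N = m - 3 it is N² + 8 N + 12.
      0≤a : 0# ≤ a
      0≤a = ≤-respʳ-≈ (trans
          (solve 1 (λ M → let N = M :- con (+ 3) in N :* N :+ (con (+ 8) :* N :+ con (+ 12))
               := M :* M :+ con (+ 2) :* M :- con (+ 3)) refl M)
          (sym a≈))
        (+-nonneg (*-nonneg 0≤N 0≤N) (+-nonneg (*-nonneg (0≤ofℤ 8) 0≤N) (0≤ofℤ 12)))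

      t² : t * t ≈ M * M + ofℤ (+ 2) * M - ofℤ (+ 3)
      t² = trans (√-square 0≤a) a≈

      st-bound : M * M + M ≤ s * t
      st-bound = square-cancel-≤ (*-nonneg (√-nonneg _) (√-nonneg _)) (≤-by
        (trans (+-congʳ (trans (solve 2 (λ s t → (s :* t) :* (s :* t)
                                    := (s :* s) :* (t :* t)) refl s t) (*-cong s² t²)))
          (solve 1 (λ M → (M :* M :+ con (+ 4)) :* (M :* M :+ con (+ 2) :* M :- con (+ 3)) :- (M :* M :+ M) :* (M :* M :+ M)
                       := con (+ 8) :* (M :- con (+ 3)) :+ con (+ 12)) refl M))
        (+-nonneg (*-nonneg (0≤ofℤ 8) 0≤N) (0≤ofℤ 12)))

      2M+1≤s+t : M + M + 1# ≤ s + t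
      2M+1≤s+t = square-cancel-≤ (+-nonneg (√-nonneg _) (√-nonneg _)) (≤-by
        (trans (+-congʳ (trans (solve 2 (λ s t → (s :+ t) :* (s :+ t)
                                    := s :* s :+ t :* t :+ con (+ 2) :* (s :* t)) refl s t)
                               (+-congʳ (+-cong s² t²))))
          (solve 2 (λ M p → ((M :* M :+ con (+ 4)) :+ (M :* M :+ con (+ 2) :* M :- con (+ 3)) :+ con (+ 2) :* p)
                              :- (M :+ M :+ con (+ 1)) :* (M :+ M :+ con (+ 1))
                         := con (+ 2) :* (p :- (M :* M :+ M))) refl M (s * t)))
        (*-nonneg (0≤ofℤ 2) (x≤y⇒0≤y-x st-bound)))

      rearrange : (s - M) - (fromℕ (m ℕ.+ 1) - t) ≈ (s + t) - (M + M + 1#)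
      rearrange = trans (+-congˡ (-‿cong (+-congʳ (trans (×-homo-+ 1# m 1) (+-congˡ (+-identityʳ 1#))))))
        (solve 3 (λ s t M → (s :- M) :- ((M :+ con (+ 1)) :- t)
             := (s :+ t) :- (M :+ M :+ con (+ 1))) refl s t M)

  realMonic : ∀ {n} → Vec ℤ n → Carrier → Carrier
  realMonic []      x = 1#
  realMonic (a ∷ p) x = ofℤ a + x * realMonic p x

  evalMonic-ofReal : ∀ {n} (p : Vec ℤ n) x →
                     evalMonic (Vec.map (λ a → ofReal (fromℤ a)) p) (ofReal x) ≈ᶜ ofReal (realMonic p x)
  evalMonic-ofReal []      x = C.refl
  evalMonic-ofReal (a ∷ p) x = C.trans
    (C.+-cong (fromℤ≈ofℤ a , refl)
      (C.trans (C.*-congˡ {ofReal x} (evalMonic-ofReal p x)) (C.sym (ofReal-homo-* x (realMonic p x)))))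
    (C.sym (ofReal-homo-+ (ofℤ a) (x * realMonic p x)))

  -- Quartic(-x) = quarticGrowth x - 1.
  quarticGrowth : Carrier → Carrier
  quarticGrowth x = x * (ofℤ (+ 2) + x * (1# + x * (ofℤ (+ 3) + x)))

  quarticGrowth-growth : Growth quarticGrowth
  quarticGrowth-growth =
    *-growth id-growth (const+-growth _ (0≤ofℤ 2)
      (*-growth id-growth (const+-growth _ 0≤1
        (*-growth id-growth (const+-growth _ (0≤ofℤ 3) id-growth)))))

  -- The value of `quarticGrowth` is 0 at 0 and 7 at 1. The solution u gives the real root -u of the
  -- quartic.
  quartic-root : ∃[ u ] 0# ≤ u × quarticGrowth u ≈ 1#
  quartic-root = solution quarticGrowth-growth {y = 1#}
    (≤-respˡ-≈ (sym (zeroˡ _)) 0≤1) 0<1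
    (<-by (solve 0 (con (+ 1) :* (con (+ 2) :+ con (+ 1) :* (con (+ 1) :+ con (+ 1) :* (con (+ 3) :+ con (+ 1)))) :- con (+ 1)
             := con (+ 1) :+ con (+ 5)) refl)
          (+-pos-nonneg 0<1 (0≤ofℤ 5)))

  isRoot-quartic : ∀ {u} → quarticGrowth u ≈ 1# → IsRootℤ quartic (ofReal (- u))
  isRoot-quartic {u} hu≈1 = C.trans (evalMonic-ofReal quartic (- u))
    (trans (solve 1 (λ u → con -[1+ 0 ] :+ (:- u) :* (con -[1+ 1 ] :+ (:- u) :* (con (+ 1) :+ (:- u) :* (con -[1+ 2 ] :+ (:- u) :* con (+ 1))))
                     := u :* (con (+ 2) :+ u :* (con (+ 1) :+ u :* (con (+ 3) :+ u))) :- con (+ 1))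
                     refl u)
      (trans (+-congʳ hu≈1) (-‿inverseʳ 1#)) , refl)

  module _ {b : Carrier} (0≤b : 0# ≤ b) (b²+2b≈1 : b * b + ofℤ (+ 2) * b ≈ 1#) where

    -- The identity (1 - 3 b) (3 b + 7) + 2 = 9 (1 - b² - 2 b) has right side 0, whereas 3 b < 1
    -- would make its left side positive.
    1≤3b : 1# ≤ ofℤ (+ 3) * b
    1≤3b 3b<1 = <-irrefl (sym eq) (+-pos-nonneg
        (*-pos (x<y⇒0<y-x 3b<1) (<-respʳ-≈ (+-comm (ofℤ (+ 7)) _)
          (+-pos-nonneg (<-respʳ-≈ (fromℤ≈ofℤ (+ 7)) (0<fromℕ 6)) (*-nonneg (0≤ofℤ 3) 0≤b))))
        (0≤ofℤ 2))
      where
      eq : (1# - ofℤ (+ 3) * b) * (ofℤ (+ 3) * b + ofℤ (+ 7)) + ofℤ (+ 2) ≈ 0#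
      eq = trans
        (solve 1 (λ b → (con (+ 1) :- con (+ 3) :* b) :* (con (+ 3) :* b :+ con (+ 7)) :+ con (+ 2)
                     := con (+ 9) :* (con (+ 1) :- (b :* b :+ con (+ 2) :* b))) refl b)
        (trans (*-congˡ (trans (+-congˡ (-‿cong b²+2b≈1)) (-‿inverseʳ 1#))) (zeroʳ _))

    -- Modulo b² + 2 b - 1 the quartic expression reduces to 3 b, the quotient being b² + b.
    1≤quarticGrowth : 1# ≤ quarticGrowth b
    1≤quarticGrowth = ≤-respʳ-≈ (sym eq) 1≤3b
      where
      eq : quarticGrowth b ≈ ofℤ (+ 3) * b
      eq = trans
        (solve 1 (λ b → b :* (con (+ 2) :+ b :* (con (+ 1) :+ b :* (con (+ 3) :+ b)))
                     := con (+ 3) :* b :+ ((b :* b :+ con (+ 2) :* b) :- con (+ 1)) :* (b :* b :+ b))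
                     refl b)
        (trans (+-congˡ (trans (*-congʳ (trans (+-congʳ b²+2b≈1) (-‿inverseʳ 1#))) (zeroˡ _))) (+-identityʳ _))

  -- Minimality is only tested against the real root -u, so it need not be known which root attains
  -- the minimum.
  minimalModulus-≤-root : ∀ {z} → IsRootOfMinimalModulus quartic z →
                          ∀ {u} → 0# ≤ u → quarticGrowth u ≈ 1# → ∣ z ∣ ≤ u
  minimalModulus-≤-root (_ , minimal) {u} 0≤u hu≈1 =
    ≤-trans (minimal (ofReal (- u)) (isRoot-quartic hu≈1)) (inDisc-∣∣ {u} {ofReal (- u)} -u∈)
    where
    -u∈ : InDisc u (ofReal (- u))
    -u∈ = inDisc-ofReal 0≤u (≤-respʳ-≈ (+-congˡ (sym (-‿involutive u))) (+-nonneg 0≤u 0≤u))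
                            (≤-reflexive (sym (-‿inverseʳ u)))

  quarticRoot-≤ : ∀ {u} → quarticGrowth u ≈ 1# → u ≤ realBound 2
  quarticRoot-≤ hu≈1 b<u = 1≤quarticGrowth (realBound-nonneg 2)
    (trans (+-congˡ (*-congʳ (sym (fromℤ≈ofℤ (+ 2))))) (realBound-root 2))
    (<-respʳ-≈ hu≈1 (Growth.mono-< quarticGrowth-growth (realBound-nonneg 2) b<u))

  minimalModulus-≤ : ∀ {z} → IsRootOfMinimalModulus quartic z → ∣ z ∣ ≤ realBound 2
  minimalModulus-≤ z-min = let u , 0≤u , hu≈1 = quartic-root in
    ≤-trans (minimalModulus-≤-root z-min 0≤u hu≈1) (quarticRoot-≤ hu≈1)

  c-≤ : ∀ m → 1 ℕ.≤ m → ∀ {c} → Is-c m c → c ≤ realBound m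
  -- For m = 1 both sides are (√5 - 1) / 2; only `1#` and `fromℕ 1` differ in form.
  c-≤ 1 _ c≈ = ≤-reflexive (trans c≈ (*-congʳ (+-congˡ (-‿cong (sym (+-identityʳ 1#))))))
  c-≤ 2 _ (z , z-min , c≈∣z∣) = ≤-respˡ-≈ (sym c≈∣z∣) (minimalModulus-≤ z-min)
  c-≤ m@(suc (suc (suc _))) _ c≈ = ≤-respˡ-≈ (sym c≈) (c-large-≤ m (s≤s (s≤s (s≤s z≤n))))

-- The bound for all conjugates.

module Bound {ℓ} (ℝ : RealNumbers ℓ) where
  open Reals ℝ
  open OrderedField ℝ
  open Complex ℝ
  open RootBound ℝ
  open Conjugates ℝ
  open GreedyExpansions ℝ
  open Roots ℝ
  open Constants ℝ

  conjugate-bound : ∀ m → 1 ℕ.≤ m → ∀ {q} → q < fromℕ (m ℕ.+ 1) → IsSimpleParry q →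
                    ∀ {q′} → IsGaloisConjugate (ofReal q) q′ → realBound m ≤ ∣ q′ ∣
  conjugate-bound m 1≤m {q} q<m+1 (1<q , _ , expansion) {q′} conj R<b =
    contradict (trim m q 0<q q<m+1 ≤-refl expansion)
    where
    M R b : Carrier
    M = fromℕ m
    R = ∣ q′ ∣
    b = realBound m

    0<q : 0# < q
    0<q = <-trans 0<1 1<q

    0≤R : 0# ≤ R
    0≤R = √-nonneg _

    -- Replacing 1 by b² + m b turns D into (b - R) (b + R + m).
    0<D : 0# < 1# - (M * R + R * R)
    0<D = <-respʳ-≈
      (trans (solve 3 (λ M R b → (b :- R) :* ((b :- R) :+ (R :+ R :+ M))
                  := (b :* b :+ M :* b) :- (M :* R :+ R :* R)) refl M R b)
             (+-congʳ (realBound-root m)))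
      (*-pos 0<b-R (+-pos-nonneg 0<b-R (+-nonneg (+-nonneg 0≤R 0≤R) (0≤fromℕ m))))
      where 0<b-R = x<y⇒0<y-x R<b

    contradict : 1# ≈ 0# ⊎ TrimmedExpansion m q 0<q q<m+1 1# → ⊥
    contradict (inj₁ 1≈0) = <-irrefl (sym 1≈0) 0<1
    contradict (inj₂ (a , as , as≤m , pos , q-orbit≈0)) =
      orbit-no-zero m 1≤m R q′ (∣∣-inDisc q′) 0<D a as as≤m pos (conjugate-orbit conj (a ∷ as) q-orbit≈0)

theorem2p4 : ∀ {ℓ} (ℝ : RealNumbers ℓ) → let open Reals ℝ in
    (m : ℕ) → 1 ℕ.≤ m →
    (q : Carrier) → fromℕ m < q → q < fromℕ (m ℕ.+ 1) →
    IsPisot q → IsSimpleParry q →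
    (cₘ : Carrier) → Is-c m cₘ →
    (∀ q′ → IsGaloisConjugate (ofReal q) q′ → cₘ ≤ ∣ q′ ∣) ×
    (∀ q′ → IsGaloisConjugate (ofReal q) (ofReal q′) → ¬ (q′ ≈ q) →
    ((√ (fromℕ (m ℕ.^ 2 ℕ.+ 4)) - fromℕ m) / 2 ≤ ∣ ofReal q′ ∣) ×
    (cₘ ≤ (√ (fromℕ (m ℕ.^ 2 ℕ.+ 4)) - fromℕ m) / 2))
theorem2p4 ℝ m 1≤m q _ q<m+1 _ parry cₘ is-c =
  (λ _ conj → ≤-trans c≤b (conjugate-bound m 1≤m q<m+1 parry conj)) ,
  (λ _ conj _ → conjugate-bound m 1≤m q<m+1 parry conj , c≤b)
  where
  open Reals ℝ
  open OrderedField ℝ using (≤-trans)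
  open Constants ℝ using (realBound; c-≤)
  open Bound ℝ using (conjugate-bound)
  c≤b : cₘ ≤ realBound m
  c≤b = c-≤ m 1≤m is-c
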